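{- Let $n\ge 3$ be an integer, let $f(x)=f_0+f_1x+f_2x^2$ and $g(x)=g_0+g_1x+\cdots+g_nx^n$ be generic polynomials (all $f_i,g_j$ are independent indeterminates), and let $A_n$ be the integer defined in the context. The coefficient of highest absolute value in the expansion of $\mathrm{Res}(f_0+f_1x+f_2x^2,\,g)$ as a polynomial in the variables $f_i,g_j$ is the coefficient corresponding to the monomial $g_0g_nf_0^{A_n}f_1^{n-2A_n}f_2^{A_n}$. Moreover, $$H\big(\mathrm{Res}(f_0+f_1x+f_2x^2,\,g)\big)=H\big(\mathrm{Res}(f_0+f_1x+f_2x^2,\,g_0+g_nx^n)\big)=n\,\frac{(n-A_n-1)!}{(n-2A_n)!\,A_n!}.$$
   Context: For $f=f_0+\cdots+f_mx^m$ and $g=g_0+\cdots+g_nx^n$ with indeterminate coefficients, $\mathrm{Res}(f,g)$ is the Sylvester resultant: the determinant of the $(m+n)\times(m+n)$ matrix whose first $n$ columns are successive downward shifts of the coefficient vector of $f$ (for $1\le j\le n$, column $j$ has entry $f_i$ in row $i+j$, $0\le i\le m$, and zeros elsewhere) and whose last $m$ columns are successive downward shifts of the coefficient vector of $g$ (for $1\le j\le m$, column $n+j$ has entry $g_i$ in row $i+j$, $0\le i\le n$, and zeros elsewhere). It is a polynomial with integer coefficients in the variables $f_i,g_j$. $\mathrm{Res}(f,g_0+g_nx^n)$ denotes the resultant with $g_1=\cdots=g_{n-1}=0$, where $g$ is still regarded as having degree $n$. The (absolute) height of a polynomial $P=\sum_\alpha c_\alpha U^\alpha\in\mathbb{C}[U_1,\dots,U_p]$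 is $H(P)=\max_\alpha|c_\alpha|$. For $n\ge 3$ let $p_n(z)=(n-2z+1)(n-2z+2)-z(n-z)$, a quadratic polynomial in $z$ with $p_n(0)>0$ and $p_n(n/2)<0$. Let $r_n$ be the unique root of $p_n$ in $[0,n/2]$ and set $A_n=\lfloor r_n\rfloor$. (One has $A_n<n/2$.) -}

module Defs where

open import Algebra.Bundles.Raw using (RawRing)
import Algebra.Definitions.RawSemiring as RawSemiringOps
open import Data.Bool.Base using (if_then_else_; _∨_)
open import Data.Fin.Base as Fin using (Fin; zero; suc; toℕ; fromℕ; punchIn; splitAt; _↑ˡ_; _↑ʳ_)
import Data.Fin.Properties as Fin
open import Data.Integer.Base as ℤ using (ℤ; 0ℤ; 1ℤ; +_)
open import Data.List.Base using (List; []; _∷_; _++_; map; foldr; cartesianProductWith)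
import Data.List.Extrema.Nat as Extrema
open import Data.Nat.Base as ℕ using (ℕ; zero; suc; z≤n; s≤s; _∸_; _!)
import Data.Nat.Properties as ℕ
open import Data.Product.Base using (_×_; _,_; proj₂; ∃-syntax)
open import Data.Rational.Base as ℚ using (ℚ; 0ℚ; 1ℚ; ½; _+_; _*_; _-_; -_; _≤_; _<_; ∣_∣; 1/_)
open import Data.Rational.Properties
open import Data.Rational.Solver using (module +-*-Solver)
open import Data.Sum.Base using ([_,_]′)
open import Data.Vec.Base as Vec using (Vec; replicate; zipWith; _[_]≔_)
open import Data.Vec.Functional using (Vector)
open import Data.Vec.Properties using (≡-dec)
open import Level using (0ℓ)
open import Relation.Binary.PropositionalEquality using (_≡_; refl; sym; trans; cong; cong₂; subst)
open import Relation.Nullary.Decidable using (does)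

-- Real numbers: Cauchy sequences of rationals, up to _≃ᴿ_.
record ℝ : Set where
  field
    seq    : ℕ → ℚ
    cauchy : ∀ ε → 0ℚ < ε →
             ∃[ N ] (∀ i j → N ℕ.≤ i → N ℕ.≤ j → ∣ seq i - seq j ∣ ≤ ε)

open ℝ public

infix 4 _≃ᴿ_ _≤ᴿ_ _<ᴿ_

_≃ᴿ_ : ℝ → ℝ → Set
x ≃ᴿ y = ∀ ε → 0ℚ < ε → ∃[ N ] (∀ i → N ℕ.≤ i → ∣ seq x i - seq y i ∣ ≤ ε)

_≤ᴿ_ : ℝ → ℝ → Set
x ≤ᴿ y = ∀ ε → 0ℚ < ε → ∃[ N ] (∀ i → N ℕ.≤ i → seq x i ≤ seq y i + ε)

_<ᴿ_ : ℝ → ℝ → Set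
x <ᴿ y = ∃[ ε ] 0ℚ < ε × ∃[ N ] (∀ i → N ℕ.≤ i → seq x i + ε ≤ seq y i)

private
  half-pos : ∀ {ε} → 0ℚ < ε → 0ℚ < ½ * ε
  half-pos {ε} 0<ε = subst (_< ½ * ε) (*-zeroʳ ½) (*-monoʳ-<-pos ½ 0<ε)

  halves : ∀ ε → ½ * ε + ½ * ε ≡ ε
  halves ε = begin-equality
    ½ * ε + ½ * ε  ≡⟨ *-distribʳ-+ ε ½ ½ ⟨
    1ℚ * ε         ≡⟨ *-identityˡ ε ⟩
    ε              ∎
    where open ≤-Reasoning

  mul-mono : ∀ {a b c d} → 0ℚ ≤ a → 0ℚ ≤ d → a ≤ b → c ≤ d → a * c ≤ b * d
  mul-mono {a} {b} {c} {d} 0≤a 0≤d a≤b c≤d = ≤-trans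
    (*-monoˡ-≤-nonNeg a {{ℚ.nonNegative 0≤a}} c≤d)
    (*-monoʳ-≤-nonNeg d {{ℚ.nonNegative 0≤d}} a≤b)

  bound-near : ∀ a b {δ} → ∣ a - b ∣ ≤ δ → ∣ a ∣ ≤ δ + ∣ b ∣
  bound-near a b {δ} near = begin
    ∣ a ∣              ≡⟨ cong ∣_∣ (solve 2 (λ a b → a := a :- b :+ b) refl a b) ⟩
    ∣ (a - b) + b ∣    ≤⟨ ∣p+q∣≤∣p∣+∣q∣ (a - b) b ⟩
    ∣ a - b ∣ + ∣ b ∣  ≤⟨ +-monoˡ-≤ ∣ b ∣ near ⟩
    δ + ∣ b ∣          ∎
    where
    open ≤-Reasoning
    open +-*-Solver

  near-+ : ∀ a b c d {δ η} → ∣ a - c ∣ ≤ δ → ∣ b - d ∣ ≤ η → ∣ (a + b) - (c + d) ∣ ≤ δ + η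
  near-+ a b c d {δ} {η} a~c b~d = begin
    ∣ (a + b) - (c + d) ∣  ≡⟨ cong ∣_∣ (solve 4 (λ a b c d → (a :+ b) :- (c :+ d) := (a :- c) :+ (b :- d)) refl a b c d) ⟩
    ∣ (a - c) + (b - d) ∣  ≤⟨ ∣p+q∣≤∣p∣+∣q∣ (a - c) (b - d) ⟩
    ∣ a - c ∣ + ∣ b - d ∣  ≤⟨ +-mono-≤ a~c b~d ⟩
    δ + η                  ∎
    where
    open ≤-Reasoning
    open +-*-Solver

  near-neg : ∀ a b {δ} → ∣ b - a ∣ ≤ δ → ∣ - a - - b ∣ ≤ δ
  near-neg a b {δ} = subst (λ q → ∣ q ∣ ≤ δ)
    (solve 2 (λ a b → b :- a := :- a :- :- b) refl a b)
    where open +-*-Solver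

  near-* : ∀ a b c d {B C δ η} → 0ℚ ≤ δ → 0ℚ ≤ η → ∣ a ∣ ≤ B → ∣ d ∣ ≤ C →
           ∣ a - c ∣ ≤ η → ∣ b - d ∣ ≤ δ → ∣ a * b - c * d ∣ ≤ B * δ + C * η
  near-* a b c d {B} {C} {δ} {η} 0≤δ 0≤η ∣a∣≤B ∣d∣≤C a~c b~d = begin
    ∣ a * b - c * d ∣                      ≡⟨ cong ∣_∣ (solve 4 (λ a b c d → a :* b :- c :* d := a :* (b :- d) :+ d :* (a :- c)) refl a b c d) ⟩
    ∣ a * (b - d) + d * (a - c) ∣          ≤⟨ ∣p+q∣≤∣p∣+∣q∣ (a * (b - d)) (d * (a - c)) ⟩
    ∣ a * (b - d) ∣ + ∣ d * (a - c) ∣      ≡⟨ cong₂ _+_ (∣p*q∣≡∣p∣*∣q∣ a (b - d)) (∣p*q∣≡∣p∣*∣q∣ d (a - c)) ⟩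
    ∣ a ∣ * ∣ b - d ∣ + ∣ d ∣ * ∣ a - c ∣  ≤⟨ +-mono-≤ (mul-mono (0≤∣p∣ a) 0≤δ ∣a∣≤B b~d) (mul-mono (0≤∣p∣ d) 0≤η ∣d∣≤C a~c) ⟩
    B * δ + C * η                          ∎
    where
    open ≤-Reasoning
    open +-*-Solver

  eventually-bounded : ∀ x → ∃[ N ] ∃[ B ] 0ℚ < B × (∀ i → N ℕ.≤ i → ∣ seq x i ∣ ≤ B)
  eventually-bounded x with cauchy x 1ℚ (positive⁻¹ 1ℚ)
  ... | N , close = N , 1ℚ + ∣ seq x N ∣
    , +-mono-<-≤ (positive⁻¹ 1ℚ) (0≤∣p∣ (seq x N))
    , λ i N≤i → bound-near (seq x i) (seq x N) (close i N N≤i ℕ.≤-refl)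

  share : ∀ {B ε} → 0ℚ < B → 0ℚ < ε → ∃[ δ ] 0ℚ < δ × B * δ ≡ ½ * ε
  share {B} {ε} 0<B 0<ε = 1/ B * (½ * ε)
    , subst (_< 1/ B * (½ * ε)) (*-zeroʳ (1/ B)) (*-monoʳ-<-pos (1/ B) (half-pos 0<ε))
    , (begin-equality
        B * (1/ B * (½ * ε))  ≡⟨ *-assoc B (1/ B) (½ * ε) ⟨
        B * 1/ B * (½ * ε)    ≡⟨ cong (_* (½ * ε)) (*-inverseʳ B) ⟩
        1ℚ * (½ * ε)          ≡⟨ *-identityˡ (½ * ε) ⟩
        ½ * ε                 ∎)
    where
    open ≤-Reasoning
    instance
      B-pos : ℚ.Positive B
      B-pos = ℚ.positive 0<B
      B-nonZero : ℚ.NonZero B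
      B-nonZero = pos⇒nonZero B
      1/B-pos : ℚ.Positive (1/ B)
      1/B-pos = 1/pos⇒pos B

infixl 6 _+ᴿ_ _-ᴿ_
infixl 7 _*ᴿ_
infix  8 -ᴿ_

constᴿ : ℚ → ℝ
seq    (constᴿ q) _ = q
cauchy (constᴿ q) ε 0<ε = 0 , λ _ _ _ _ →
  subst (_≤ ε) (cong ∣_∣ (sym (+-inverseʳ q))) (<⇒≤ 0<ε)

fromℕᴿ : ℕ → ℝ
fromℕᴿ k = constᴿ (+ k ℚ./ 1)

_+ᴿ_ : ℝ → ℝ → ℝ
seq    (x +ᴿ y) i = seq x i + seq y i
cauchy (x +ᴿ y) ε 0<ε
  with cauchy x (½ * ε) (half-pos 0<ε) | cauchy y (½ * ε) (half-pos 0<ε)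
... | M , closeˣ | N , closeʸ = M ℕ.⊔ N , λ i j p q →
  subst (∣ (seq x i + seq y i) - (seq x j + seq y j) ∣ ≤_) (halves ε)
    (near-+ (seq x i) (seq y i) (seq x j) (seq y j)
      (closeˣ i j (ℕ.m⊔n≤o⇒m≤o M N p) (ℕ.m⊔n≤o⇒m≤o M N q))
      (closeʸ i j (ℕ.m⊔n≤o⇒n≤o M N p) (ℕ.m⊔n≤o⇒n≤o M N q)))

-ᴿ_ : ℝ → ℝ
seq    (-ᴿ x) i = - seq x i
cauchy (-ᴿ x) ε 0<ε with cauchy x ε 0<ε
... | N , close = N , λ i j p q → near-neg (seq x i) (seq x j) (close j i q p)

_-ᴿ_ : ℝ → ℝ → ℝ
x -ᴿ y = x +ᴿ -ᴿ y

private
  cauchy-* : ∀ x y ε → 0ℚ < ε →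
    ∃[ N ] (∀ i j → N ℕ.≤ i → N ℕ.≤ j → ∣ seq x i * seq y i - seq x j * seq y j ∣ ≤ ε)
  cauchy-* x y ε 0<ε =
    let K , B , 0<B , boundˣ = eventually-bounded x
        L , C , 0<C , boundʸ = eventually-bounded y
        δ , 0<δ , Bδ≡ε/2 = share 0<B 0<ε
        η , 0<η , Cη≡ε/2 = share 0<C 0<ε
        M , closeˣ = cauchy x η 0<η
        N , closeʸ = cauchy y δ 0<δ
    in (K ℕ.⊔ L) ℕ.⊔ (M ℕ.⊔ N) , λ i j p q →
      let KL≤ : ∀ {k} → (K ℕ.⊔ L) ℕ.⊔ (M ℕ.⊔ N) ℕ.≤ k → K ℕ.⊔ L ℕ.≤ k
          KL≤ = ℕ.m⊔n≤o⇒m≤o (K ℕ.⊔ L) (M ℕ.⊔ N)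
          MN≤ : ∀ {k} → (K ℕ.⊔ L) ℕ.⊔ (M ℕ.⊔ N) ℕ.≤ k → M ℕ.⊔ N ℕ.≤ k
          MN≤ = ℕ.m⊔n≤o⇒n≤o (K ℕ.⊔ L) (M ℕ.⊔ N)
      in subst (∣ seq x i * seq y i - seq x j * seq y j ∣ ≤_)
        (trans (cong₂ _+_ Bδ≡ε/2 Cη≡ε/2) (halves ε))
        (near-* (seq x i) (seq y i) (seq x j) (seq y j) (<⇒≤ 0<δ) (<⇒≤ 0<η)
          (boundˣ i (ℕ.m⊔n≤o⇒m≤o K L (KL≤ p)))
          (boundʸ j (ℕ.m⊔n≤o⇒n≤o K L (KL≤ q)))
          (closeˣ i j (ℕ.m⊔n≤o⇒m≤o M N (MN≤ p)) (ℕ.m⊔n≤o⇒m≤o M N (MN≤ q)))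
          (closeʸ i j (ℕ.m⊔n≤o⇒n≤o M N (MN≤ p)) (ℕ.m⊔n≤o⇒n≤o M N (MN≤ q))))

_*ᴿ_ : ℝ → ℝ → ℝ
seq    (x *ᴿ y) i = seq x i * seq y i
cauchy (x *ᴿ y) = cauchy-* x y

p : ℕ → ℝ → ℝ
p n z = (n′ -ᴿ fromℕᴿ 2 *ᴿ z +ᴿ fromℕᴿ 1) *ᴿ (n′ -ᴿ fromℕᴿ 2 *ᴿ z +ᴿ fromℕᴿ 2)
        -ᴿ z *ᴿ (n′ -ᴿ z)
  where
  n′ : ℝ
  n′ = fromℕᴿ n

record IsRootIn[0,n/2] (n : ℕ) (r : ℝ) : Set where
  field
    0≤r   : fromℕᴿ 0 ≤ᴿ r
    r≤n/2 : r ≤ᴿ constᴿ (+ n ℚ./ 2)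
    pr≃0  : p n r ≃ᴿ fromℕᴿ 0

-- Floors of nonnegative reals only, so that the value may be taken in ℕ.
record IsFloor (r : ℝ) (A : ℕ) : Set where
  field
    A≤r   : fromℕᴿ A ≤ᴿ r
    r<1+A : r <ᴿ fromℕᴿ (suc A)

module Resultant {c ℓ} (R : RawRing c ℓ) where

  open RawRing R renaming (_+_ to _⊕_; _*_ to _⊛_; -_ to ⊖_)
  open RawSemiringOps rawSemiring using (sum; _^_)

  -- First index: row; second index: column.
  Matrix : ℕ → Set c
  Matrix k = Fin k → Fin k → Carrier

  det : ∀ {k} → Matrix k → Carrier
  det {zero}  M = 1#
  det {suc k} M = sum λ j →
    (⊖ 1#) ^ toℕ j ⊛ (M zero j ⊛ det (λ r s → M (suc r) (punchIn j s)))

  entry : ∀ {k} → Vector Carrier k → ℕ → Carrier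
  entry {zero}  a _       = 0#
  entry {suc k} a zero    = a zero
  entry {suc k} a (suc i) = entry (λ l → a (suc l)) i

  -- shiftDown j a r is a_{r-j}, and 0 when r < j.
  shiftDown : ℕ → (ℕ → Carrier) → ℕ → Carrier
  shiftDown zero    a r       = a r
  shiftDown (suc j) a zero    = 0#
  shiftDown (suc j) a (suc r) = shiftDown j a r

  -- Rows and columns are numbered from 0, so column j of the f-block
  -- has f_i in row i + j.
  sylvester : ∀ {m n} → Vector Carrier (suc m) → Vector Carrier (suc n) → Matrix (n ℕ.+ m)
  sylvester {m} {n} f g r s =
    [ (λ j → shiftDown (toℕ j) (entry f) (toℕ r))
    , (λ j → shiftDown (toℕ j) (entry g) (toℕ r))
    ]′ (splitAt n s)

  Res : ∀ {m n} → Vector Carrier (suc m) → Vector Carrier (suc n) → Carrier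
  Res {m} {n} f g = det (sylvester {m} {n} f g)

  -- g₀ + gₙxⁿ, still as a coefficient vector of formal degree n.
  endsOnly : ∀ {n} → Vector Carrier (suc n) → Vector Carrier (suc n)
  endsOnly {n} g i = if does (i Fin.≟ zero) ∨ does (i Fin.≟ fromℕ n) then g i else 0#

Monomial : ℕ → Set
Monomial k = Vec ℕ k

-- A polynomial over ℤ in k indeterminates is a formal sum of terms.
-- Monomials may be repeated or have cancelling terms, so only coeff is meaningful.
Poly : ℕ → Set
Poly k = List (ℤ × Monomial k)

infixl 7 _·_
infixr 8 _^ᴹ_

_·_ : ∀ {k} → Monomial k → Monomial k → Monomial k
_·_ = zipWith ℕ._+_

_^ᴹ_ : ∀ {k} → Monomial k → ℕ → Monomial k
α ^ᴹ e = Vec.map (e ℕ.*_) α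

varᴹ : ∀ {k} → Fin k → Monomial k
varᴹ {k} i = replicate k 0 [ i ]≔ 1

coeff : ∀ {k} → Poly k → Monomial k → ℤ
coeff P α = foldr (λ (c , β) s → (if does (≡-dec ℕ._≟_ β α) then c else 0ℤ) ℤ.+ s) 0ℤ P

monoPoly : ∀ {k} → Monomial k → Poly k
monoPoly α = (1ℤ , α) ∷ []

polyRing : ℕ → RawRing 0ℓ 0ℓ
polyRing k = record
  { Carrier = Poly k
  ; _≈_     = λ P Q → ∀ α → coeff P α ≡ coeff Q α
  ; _+_     = _++_
  ; _*_     = cartesianProductWith (λ (c , α) (d , β) → c ℤ.* d , α · β)
  ; -_      = map (λ (c , α) → ℤ.- c , α)
  ; 0#      = []
  ; 1#      = monoPoly (replicate k 0)
  }

-- The maximum of the absolute values of the coefficients; monomials not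
-- listed in P have coefficient 0 and cannot contribute.
H : ∀ {k} → Poly k → ℕ
H P = Extrema.max 0 (map (λ (_ , α) → ℤ.∣ coeff P α ∣) P)

-- The indeterminates are f₀, f₁, f₂, g₀, …, gₙ, in this order.
numVars : ℕ → ℕ
numVars n = 3 ℕ.+ suc n

fᴹ : ∀ n → Fin 3 → Monomial (numVars n)
fᴹ n i = varᴹ (i ↑ˡ suc n)

gᴹ : ∀ n → Fin (suc n) → Monomial (numVars n)
gᴹ n j = varᴹ (3 ↑ʳ j)

genericF : ∀ n → Vector (Poly (numVars n)) 3
genericF n i = monoPoly (fᴹ n i)

genericG : ∀ n → Vector (Poly (numVars n)) (suc n)
genericG n j = monoPoly (gᴹ n j)

resFG : ∀ n → Poly (numVars n)
resFG n = Res {2} {n} (genericF n) (genericG n)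
  where open Resultant (polyRing (numVars n))

resFEnds : ∀ n → Poly (numVars n)
resFEnds n = Res {2} {n} (genericF n) (endsOnly {n} (genericG n))
  where open Resultant (polyRing (numVars n))

-- g₀ gₙ f₀^A f₁^(n-2A) f₂^A.
topMonomial : (n A : ℕ) → Monomial (numVars n)
topMonomial n A =
  gᴹ n zero · gᴹ n (fromℕ n)
  · fᴹ n zero ^ᴹ A · fᴹ n (suc zero) ^ᴹ (n ∸ 2 ℕ.* A) · fᴹ n (suc (suc zero)) ^ᴹ A

-- n (n-A-1)! / ((n-2A)! A!), as a rational number. The truncated
-- subtractions are exact because A < n/2.
heightFormula : (n A : ℕ) → ℚ
heightFormula n A =
  (+ (n ℕ.* (n ∸ A ∸ 1) !) ℚ./ ((n ∸ 2 ℕ.* A) ! ℕ.* A !))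
    {{(n ∸ 2 ℕ.* A) ℕ.!* A !≢0}}

{-# OPTIONS --safe #-}
module Submission where

-- If f = f₂ (x - α)(x - β), then the resultant is f₂^n g(α) g(β). Here g_i² has the coefficient
-- f₀^i f₂^(n-i), and g_i g_{i+k} with k > 0 has the coefficient f₀^i f₂^(n-i-k) times the power sum
-- f₂^k (α^k + β^k), a polynomial in f₁ and f₀ f₂ whose coefficients are, up to sign, the Lucas-type numbers
-- k (k-a-1)! / ((k-2a)! a!). Without roots, the same formula comes out of expanding the Sylvester
-- determinant along its first row. The monomials for different (i, k, a) are distinct, so the height is the
-- largest of these numbers over 2a ≤ k ≤ n. They increase with k, and for k = n the ratio of consecutive
-- ones exceeds 1 exactly as long as p_n(a + 1) > 0, that is, up to a = A_n.

open import Defs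
open import Algebra.Bundles using (CommutativeRing)
open import Algebra.Bundles.Raw using (module RawRing)
open import Data.Bool.Base using (Bool; true; false; if_then_else_; _∨_)
import Data.Bool.Properties as Bool
open import Data.Fin.Base as Fin using (Fin; zero; suc; toℕ; fromℕ; fromℕ<; punchIn; splitAt; _↑ʳ_)
import Data.Fin.Properties as Fin
open import Data.Integer.Base as ℤ using (ℤ; +_; 0ℤ; 1ℤ; ∣_∣)
import Data.Integer.Properties as ℤ
import Data.Integer.Tactic.RingSolver as ℤ-Solver
open import Data.List.Base as List using (List; []; _∷_; _++_)
import Data.List.Extrema
open import Data.List.Membership.Propositional using (_∈_)
open import Data.List.Membership.Propositional.Properties using (∈-map⁺; ∈-map⁻)
import Data.List.Properties as List
open import Data.List.Relation.Unary.All as All using ([]; _∷_)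
import Data.List.Relation.Unary.All.Properties as All
open import Data.List.Relation.Unary.AllPairs using ([]; _∷_)
open import Data.List.Relation.Unary.Any as Any using (Any; here; there)
import Data.List.Relation.Unary.Any.Properties as Any
open import Data.List.Relation.Unary.Unique.Propositional using (Unique)
import Data.List.Relation.Unary.Unique.Propositional.Properties as Unique
open import Data.Nat.Base as ℕ using (ℕ; zero; suc; _≤_; _<_; z≤n; s≤s; _∸_; _!)
import Data.Nat.Properties as ℕ
open import Data.Nat.Tactic.RingSolver using (solve-∀)
open import Data.Product.Base as Product using (_,_; ∃-syntax; proj₁; proj₂; map₁)
import Data.Rational.Properties as ℚ
open import Data.Rational.Unnormalised.Base as ℚᵘ using (mkℚᵘ; _≃_; *≡*)
import Data.Rational.Unnormalised.Properties as ℚᵘ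
open import Data.Sum.Base using (_⊎_; inj₁; inj₂; [_,_]′)
open import Data.Vec.Base as Vec using ([]; _∷_; replicate; lookup)
open import Data.Vec.Functional using (Vector)
import Data.Vec.Properties as Vec
open import Function.Base using (_∘_; const)
open import Level using (0ℓ)
open import Relation.Binary.PropositionalEquality as ≡ using (_≡_; _≢_; module ≡-Reasoning)
open import Relation.Nullary.Decidable using (does; yes; no)
open import Relation.Nullary.Negation using (contradiction)

-- The determinant is computed over an arbitrary commutative ring; only the resulting formula is
-- read in the ring of formal sums, where equality means equality of all coefficients. Expansion
-- along the first row leaves the class of Sylvester matrices, so the induction runs over matrices
-- with an f-band and two free g-columns. Deleting the first row and one g-column leaves a single
-- free column, and that determinant is linear in its entries, with complete homogeneous sums of the
-- roots as coefficients. Power sums appear when two such determinants are combined. For the height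
-- only absolute values matter, so each term is kept as one monomial with the absolute value of its
-- scalar. The root r_n is accessible only through rational approximations, which satisfy p_n = 0
-- and the bounds up to an error. They yield p_n(A_n) > -1 and, if A_n + 1 is at most n/2, also
-- p_n(A_n + 1) < 1. Both values are integers, so their signs follow without locating the root
-- exactly.

-- Index arithmetic for columns and sums

skip : ℕ → ℕ → ℕ
skip zero    s       = suc s
skip (suc j) zero    = zero
skip (suc j) (suc s) = suc (skip j s)

toℕ-punchIn : ∀ {k} (j : Fin (suc k)) s → toℕ (punchIn j s) ≡ skip (toℕ j) (toℕ s)
toℕ-punchIn zero    s       = ≡.refl
toℕ-punchIn (suc j) zero    = ≡.refl
toℕ-punchIn (suc j) (suc s) = ≡.cong suc (toℕ-punchIn j s)

-- Blocks of columns are functions on ℕ, the second one numbered from 0 again. Deleting a column of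
-- the second block is then `append-skip`, without casts between finite index types.
append : ∀ {a} {A : Set a} → ℕ → (ℕ → A) → (ℕ → A) → ℕ → A
append zero    F G s       = G s
append (suc n) F G zero    = F zero
append (suc n) F G (suc s) = append n (F ∘ suc) G s

module _ {a} {A : Set a} where

  -- The hypotheses concern the position s alone, because the families compared in `minor-last`
  -- agree only inside the determinant.
  append-cong : ∀ n {F F′ G G′ : ℕ → A} {s} →
                F s ≡ F′ s → (∀ i → n ℕ.+ i ≡ s → G i ≡ G′ i) → append n F G s ≡ append n F′ G′ s
  append-cong zero    {s = s}     p q = q s ≡.refl
  append-cong (suc n) {s = zero}  p q = p
  append-cong (suc n) {s = suc s} p q = append-cong n p (λ i eq → q i (≡.cong suc eq))

  append-left : ∀ n {s} (F G : ℕ → A) → s < n → append n F G s ≡ F s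
  append-left (suc n) {zero}  F G _         = ≡.refl
  append-left (suc n) {suc s} F G (s≤s s<n) = append-left n (F ∘ suc) G s<n

  append-right : ∀ n s (F G : ℕ → A) → append n F G (n ℕ.+ s) ≡ G s
  append-right zero    s F G = ≡.refl
  append-right (suc n) s F G = append-right n s (F ∘ suc) G

  append-skip : ∀ n j s (F G : ℕ → A) → append n F G (skip (n ℕ.+ j) s) ≡ append n F (G ∘ skip j) s
  append-skip zero    j s       F G = ≡.refl
  append-skip (suc n) j zero    F G = ≡.refl
  append-skip (suc n) j (suc s) F G = append-skip n j s (F ∘ suc) G

append-map : ∀ {a b} {A : Set a} {B : Set b} (h : A → B) n (F G : ℕ → A) s →
             h (append n F G s) ≡ append n (h ∘ F) (h ∘ G) s
append-map h zero    F G s       = ≡.refl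
append-map h (suc n) F G zero    = ≡.refl
append-map h (suc n) F G (suc s) = append-map h n (F ∘ suc) G s

splitAt-append : ∀ {a} {A : Set a} n {m} (F G : ℕ → A) (s : Fin (n ℕ.+ m)) →
                 [ (λ j → F (toℕ j)) , (λ j → G (toℕ j)) ]′ (splitAt n s) ≡ append n F G (toℕ s)
splitAt-append zero    F G s    = ≡.refl
splitAt-append (suc n) F G zero = ≡.refl
splitAt-append (suc n) F G (suc s) with splitAt n s | splitAt-append n (F ∘ suc) G s
... | inj₁ _ | eq = eq
... | inj₂ _ | eq = eq

splits : ℕ → List (ℕ Product.× ℕ)
splits zero    = (0 , 0) ∷ []
splits (suc n) = (0 , suc n) ∷ List.map (map₁ suc) (splits n)

-- The exponents (a , b) of the monomials y^a x^b of weight n, where x has weight 1 and y has weight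
-- 2.
splits₂ : ℕ → List (ℕ Product.× ℕ)
splits₂ zero          = (0 , 0) ∷ []
splits₂ (suc zero)    = (0 , 1) ∷ []
splits₂ (suc (suc n)) = (0 , suc (suc n)) ∷ List.map (map₁ suc) (splits₂ n)

-- The binomial coefficient (a+b choose a).
binom : ℕ → ℕ → ℕ
binom zero    b       = 1
binom (suc a) zero    = 1
binom (suc a) (suc b) = binom a (suc b) ℕ.+ binom (suc a) b

binom-zeroʳ : ∀ a → binom a 0 ≡ 1
binom-zeroʳ zero    = ≡.refl
binom-zeroʳ (suc a) = ≡.refl

-- With k = 2a + b, this is k (k-a-1)! / ((k-2a)! a!) when k > 0.
lucas : ℕ → ℕ → ℕ
lucas zero    b = 1
lucas (suc a) b = binom (suc a) b ℕ.+ binom a b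

-- Determinants over a commutative ring

module ResultantExpansion {c ℓ} (R : CommutativeRing c ℓ) where

  open CommutativeRing R hiding (zero)
  open Resultant rawRing
  open import Algebra.Properties.Ring ring using (-1*x≈-x; -‿involutive)
  open import Algebra.Properties.Semiring.Sum semiring
  open import Algebra.Properties.Semiring.Mult semiring using (_×_; ×-congʳ; ×-homo-+; ×-comm-*)
  open import Algebra.Properties.CommutativeSemiring.Exp commutativeSemiring
  open import Algebra.Solver.Ring.NaturalCoefficients.Default commutativeSemiring
    using (solve; _:=_; _:+_; _:*_; con)
  open import Relation.Binary.Reasoning.Setoid setoid

  Seq : Set c
  Seq = ℕ → Carrier

  tl : Seq → Seq
  tl u i = u (suc i)

  -- Signs are powers of an element of square 1, which keeps all identities within the commutative
  -- semiring solver.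
  ν : Carrier
  ν = - 1#

  ν*ν≈1 : ν * ν ≈ 1#
  ν*ν≈1 = trans (-1*x≈-x ν) (-‿involutive 1#)

  Σ< : ℕ → Seq → Carrier
  Σ< k h = sum {k} (h ∘ toℕ)

  Σ<-cong : ∀ {k} {h h′ : Seq} → (∀ {j} → j < k → h j ≈ h′ j) → Σ< k h ≈ Σ< k h′
  Σ<-cong h≈h′ = sum-cong-≋ (λ i → h≈h′ (Fin.toℕ<n i))

  Σ<-zero : ∀ k {h : Seq} → (∀ {j} → j < k → h j ≈ 0#) → Σ< k h ≈ 0#
  Σ<-zero k h≈0 = trans (Σ<-cong h≈0) (sum-replicate-zero k)

  Σ<-last : ∀ k (h : Seq) → Σ< (suc k) h ≈ Σ< k h + h k
  Σ<-last zero    h = +-comm (h 0) 0#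
  Σ<-last (suc k) h = trans (+-congˡ (Σ<-last k (tl h))) (sym (+-assoc _ _ _))

  det-cong : ∀ {k} {M N : Matrix k} → (∀ r s → M r s ≈ N r s) → det M ≈ det N
  det-cong {zero}  M≈N = refl
  det-cong {suc k} M≈N = sum-cong-≋ λ j → *-congˡ {ν ^ toℕ j}
    (*-cong (M≈N zero j) (det-cong (λ r s → M≈N (suc r) (punchIn j s))))

  -- C s r is the entry in column s and row r of an unbounded matrix, of which only the top left
  -- k × k block counts.
  detᶜ : ℕ → (ℕ → Seq) → Carrier
  detᶜ k C = det {k} (λ r s → C (toℕ s) (toℕ r))

  detᶜ-cong : ∀ k {C C′ : ℕ → Seq} → (∀ {s} → s < k → ∀ r → C s r ≈ C′ s r) → detᶜ k C ≈ detᶜ k C′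
  detᶜ-cong k C≈C′ = det-cong (λ r s → C≈C′ (Fin.toℕ<n s) (toℕ r))

  minor : ℕ → (ℕ → Seq) → ℕ → Seq
  minor j C s = tl (C (skip j s))

  detᶜ-expand : ∀ k C → detᶜ (suc k) C ≈ Σ< (suc k) λ j → ν ^ j * (C j 0 * detᶜ k (minor j C))
  detᶜ-expand k C = sum-cong-≋ λ j → *-congˡ {ν ^ toℕ j} (*-congˡ {C (toℕ j) 0}
    (det-cong {k} {λ r s → C (toℕ (punchIn j s)) (suc (toℕ r))} λ r s → reflexive (≡.cong (λ i → C i (suc (toℕ r))) (toℕ-punchIn j s))))

  vanish : ∀ x {y z} → y ≈ 0# → x * (y * z) ≈ 0#
  vanish x y≈0 = trans (*-congˡ (trans (*-congʳ y≈0) (zeroˡ _))) (zeroʳ x)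

  vanish′ : ∀ x y {z} → z ≈ 0# → x * (y * z) ≈ 0#
  vanish′ x y z≈0 = trans (*-congˡ (trans (*-congˡ z≈0) (zeroʳ y))) (zeroʳ x)

  -- In the first-row expansion only the first term takes its entry from column 0; every other minor
  -- keeps that zero column in front, so induction applies to it.
  detᶜ-zeroColumn : ∀ k C → (∀ r → C 0 r ≈ 0#) → detᶜ (suc k) C ≈ 0#
  detᶜ-zeroColumn k C C₀≈0 = trans (detᶜ-expand k C) (Σ<-zero (suc k) (term k))
    where
    term : ∀ k {j} → j < suc k → ν ^ j * (C j 0 * detᶜ k (minor j C)) ≈ 0#
    term k       {zero}  _               = vanish (ν ^ 0) (C₀≈0 0)
    term (suc k) {suc j} _ = vanish′ (ν ^ suc j) (C (suc j) 0)
      (detᶜ-zeroColumn k (minor (suc j) C) (λ r → C₀≈0 (suc r)))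
    term zero    {suc j} (s≤s ())

  -- Every minor of the expansion except the first has a leading column of zeros.
  detᶜ-firstColumn : ∀ k C → (∀ r → C 0 (suc r) ≈ 0#) → detᶜ (suc k) C ≈ C 0 0 * detᶜ k (minor 0 C)
  detᶜ-firstColumn k C C₀≈0 = begin
    detᶜ (suc k) C                             ≈⟨ detᶜ-expand k C ⟩
    1# * (C 0 0 * detᶜ k (minor 0 C)) + Σ< k h ≈⟨ +-cong (*-identityˡ _) (Σ<-zero k {h} (term k)) ⟩
    C 0 0 * detᶜ k (minor 0 C) + 0#            ≈⟨ +-identityʳ _ ⟩
    C 0 0 * detᶜ k (minor 0 C)                 ∎
    where
    h : Seq
    h j = ν ^ suc j * (C (suc j) 0 * detᶜ k (minor (suc j) C))
    term : ∀ k {j} → j < k → ν ^ suc j * (C (suc j) 0 * detᶜ k (minor (suc j) C)) ≈ 0#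
    term (suc k) {j} _ = vanish′ (ν ^ suc j) (C (suc j) 0) (detᶜ-zeroColumn k (minor (suc j) C) C₀≈0)

  Σᴸ : ∀ {a} {A : Set a} → List A → (A → Carrier) → Carrier
  Σᴸ []       h = 0#
  Σᴸ (x ∷ xs) h = h x + Σᴸ xs h

  module _ {a} {A : Set a} where

    Σᴸ-cong : ∀ (xs : List A) {h h′} → (∀ x → h x ≈ h′ x) → Σᴸ xs h ≈ Σᴸ xs h′
    Σᴸ-cong []       h≈h′ = refl
    Σᴸ-cong (x ∷ xs) h≈h′ = +-cong (h≈h′ x) (Σᴸ-cong xs h≈h′)

    Σᴸ-+ : ∀ (xs : List A) h h′ → Σᴸ xs (λ x → h x + h′ x) ≈ Σᴸ xs h + Σᴸ xs h′
    Σᴸ-+ []       h h′ = sym (+-identityˡ 0#)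
    Σᴸ-+ (x ∷ xs) h h′ = trans (+-congˡ (Σᴸ-+ xs h h′))
      (solve 4 (λ p q r s → (p :+ q) :+ (r :+ s) := (p :+ r) :+ (q :+ s)) refl (h x) (h′ x) (Σᴸ xs h) (Σᴸ xs h′))

    Σᴸ-*ˡ : ∀ (xs : List A) c h → c * Σᴸ xs h ≈ Σᴸ xs (λ x → c * h x)
    Σᴸ-*ˡ []       c h = zeroʳ c
    Σᴸ-*ˡ (x ∷ xs) c h = trans (distribˡ c (h x) (Σᴸ xs h)) (+-congˡ (Σᴸ-*ˡ xs c h))

    Σᴸ-map : ∀ {b} {B : Set b} (f : B → A) xs {h} → Σᴸ (List.map f xs) h ≡ Σᴸ xs (h ∘ f)
    Σᴸ-map f []           = ≡.refl
    Σᴸ-map f (x ∷ xs) {h} = ≡.cong (_+_ (h (f x))) (Σᴸ-map f xs)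

  -- The Sylvester determinant of a quadratic polynomial

  module Quadratic (φ : Vector Carrier 3) where

    f : Seq
    f = entry φ

    -- The f-block of the Sylvester matrix without its first d rows: band d s r is f_{d+r-s}.
    band : ℕ → ℕ → Seq
    band d s r = shiftDown s f (d ℕ.+ r)

    -- Since f₃ and all later entries vanish, this block is upper triangular with f₂ on the
    -- diagonal.
    detᶜ-band₂ : ∀ k → detᶜ k (band 2) ≈ f 2 ^ k
    detᶜ-band₂ zero    = refl
    detᶜ-band₂ (suc k) = trans (detᶜ-firstColumn k (band 2) (λ r → refl)) (*-congˡ (detᶜ-band₂ k))

    -- With the shifted coefficient vectors of g as B 0 and B 1 this is the Sylvester determinant.
    -- The columns are left free because deleting the first row truncates them.
    D : ℕ → (ℕ → Seq) → Carrier
    D n B = detᶜ (2 ℕ.+ n) (append n (band 0) B)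

    -- What remains after deleting the first row and one g-column.
    E : ℕ → Seq → Carrier
    E n w = detᶜ (1 ℕ.+ n) (append n (band 1) (const w))

    minor-append : ∀ {t} n j (F G : ℕ → Seq) → t ≡ n ℕ.+ j → ∀ s r →
                   minor t (append n F G) s r ≡ append n (λ i → tl (F i)) (λ i → tl (G (skip j i))) s r
    minor-append n j F G ≡.refl s r = ≡.trans
      (≡.cong (λ u → u (suc r)) (append-skip n j s F G))
      (≡.cong (λ u → u r) (append-map tl n F (G ∘ skip j) s))

    -- `skip j 0` is the g-column that survives the deletion: column 1 for j = 0, and column 0 for j
    -- = 1.
    minor-last : ∀ {t} n j (G : ℕ → Seq) → t ≡ n ℕ.+ j →
                 detᶜ (1 ℕ.+ n) (minor t (append n (band 0) G)) ≈ E n (tl (G (skip j 0)))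
    minor-last {t} n j G t≡n+j = detᶜ-cong (suc n) {minor t (append n (band 0) G)} λ {s} s<1+n r → reflexive (≡.trans
      (minor-append n j (band 0) G t≡n+j s r)
      (≡.cong (λ u → u r) (append-cong n {F′ = band 1} {G′ = const (tl (G (skip j 0)))} ≡.refl λ
        { zero    _  → ≡.refl
        -- The survivor stands at position n, the last one; anything after it lies outside the
        -- determinant.
        ; (suc i) ≡.refl → contradiction (ℕ.≤-pred s<1+n) (ℕ.m+1+n≰m n) })))

    D-zero : ∀ B → D 0 B ≈ B 0 0 * E 0 (tl (B 1)) + ν * (B 1 0 * E 0 (tl (B 0)))
    D-zero B = solve 5 (λ u₀ u₁ v₀ v₁ ν →
      con 1 :* (u₀ :* (con 1 :* (v₁ :* con 1) :+ con 0))
        :+ (ν :* con 1 :* (v₀ :* (con 1 :* (u₁ :* con 1) :+ con 0)) :+ con 0)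
        := u₀ :* (con 1 :* (v₁ :* con 1) :+ con 0) :+ ν :* (v₀ :* (con 1 :* (u₁ :* con 1) :+ con 0)))
      refl (B 0 0) (B 0 1) (B 1 0) (B 1 1) ν

    -- The first row contains f₀ in column 0, zeros in the rest of the band, and the top entries of
    -- the two g-columns. The minor of f₀ has the same shape again, one size smaller.
    D-suc : ∀ n B → D (suc n) B ≈
            f 0 * D n (tl ∘ B)
            + (ν ^ suc n * (B 0 0 * E (suc n) (tl (B 1))) + ν ^ suc (suc n) * (B 1 0 * E (suc n) (tl (B 0))))
    D-suc n B = begin
      D (suc n) B
        ≈⟨ detᶜ-expand (2 ℕ.+ n) C ⟩
      h 0 + Σ< (2 ℕ.+ n) (tl h)
        ≈⟨ +-cong h₀ (trans (Σ<-last (suc n) (tl h)) (+-cong (Σ<-last n (tl h)) h₂)) ⟩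
      f 0 * D n (tl ∘ B) + ((Σ< n (tl h) + h (suc n)) + ν ^ suc (suc n) * (B 1 0 * E (suc n) (tl (B 0))))
        ≈⟨ +-congˡ (+-congʳ (trans (+-cong (Σ<-zero n middle) h₁) (+-identityˡ _))) ⟩
      f 0 * D n (tl ∘ B) + (ν ^ suc n * (B 0 0 * E (suc n) (tl (B 1))) + ν ^ suc (suc n) * (B 1 0 * E (suc n) (tl (B 0))))
        ∎
      where
      C : ℕ → Seq
      C = append (suc n) (band 0) B
      h : Seq
      h j = ν ^ j * (C j 0 * detᶜ (2 ℕ.+ n) (minor j C))
      h₀ : h 0 ≈ f 0 * D n (tl ∘ B)
      h₀ = trans (*-identityˡ _) (*-congˡ (detᶜ-cong (2 ℕ.+ n) λ {s} _ r →
        reflexive (≡.cong (λ w → w r) (append-map tl n (band 0 ∘ suc) B s))))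
      middle : ∀ {j} → j < n → h (suc j) ≈ 0#
      middle {j} j<n = vanish (ν ^ suc j)
        (reflexive (≡.cong (λ w → w 0) (append-left n (band 0 ∘ suc) B j<n)))
      column : ∀ i {t} → t ≡ suc n ℕ.+ i → C t 0 ≈ B i 0
      column i ≡.refl = reflexive (≡.cong (λ w → w 0) (append-right (suc n) i (band 0) B))
      n+0 : suc n ≡ suc n ℕ.+ 0
      n+0 = ≡.sym (ℕ.+-identityʳ (suc n))
      n+1 : suc (suc n) ≡ suc n ℕ.+ 1
      n+1 = ℕ.+-comm 1 (suc n)
      h₁ : h (suc n) ≈ ν ^ suc n * (B 0 0 * E (suc n) (tl (B 1)))
      h₁ = *-congˡ (*-cong (column 0 n+0) (minor-last (suc n) 0 B n+0))
      h₂ : h (suc (suc n)) ≈ ν ^ suc (suc n) * (B 1 0 * E (suc n) (tl (B 0)))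
      h₂ = *-congˡ (*-cong (column 1 n+1) (minor-last (suc n) 1 B n+1))

    E-one : ∀ w → E 1 w ≈ f 1 * w 1 + ν * (w 0 * f 2)
    E-one w = solve 5 (λ f₁ f₂ w₀ w₁ ν →
      con 1 :* (f₁ :* (con 1 :* (w₁ :* con 1) :+ con 0))
        :+ (ν :* con 1 :* (w₀ :* (con 1 :* (f₂ :* con 1) :+ con 0)) :+ con 0)
        := f₁ :* w₁ :+ ν :* (w₀ :* f₂)) refl (f 1) (f 2) (w 0) (w 1) ν

    -- The first row is f₁, f₀, zeros, w₀. The minor of f₀ begins with the column f₂, 0, 0, ...,
    -- which splits off, and the minor of w₀ is the triangular band.
    E-suc : ∀ n w → E (2 ℕ.+ n) w ≈
            f 1 * E (suc n) (tl w) + (ν * (f 0 * (f 2 * E n (tl (tl w)))) + ν ^ (2 ℕ.+ n) * (w 0 * f 2 ^ (2 ℕ.+ n)))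
    E-suc n w = begin
      E (2 ℕ.+ n) w
        ≈⟨ detᶜ-expand (2 ℕ.+ n) C ⟩
      h 0 + (h 1 + Σ< (suc n) (λ j → h (2 ℕ.+ j)))
        ≈⟨ +-cong h₀ (+-cong h₁ (trans (Σ<-last n (λ j → h (2 ℕ.+ j))) (trans (+-cong (Σ<-zero n middle) hᵥ) (+-identityˡ _)))) ⟩
      f 1 * E (suc n) (tl w) + (ν * (f 0 * (f 2 * E n (tl (tl w)))) + ν ^ (2 ℕ.+ n) * (w 0 * f 2 ^ (2 ℕ.+ n)))
        ∎
      where
      C : ℕ → Seq
      C = append (2 ℕ.+ n) (band 1) (const w)
      h : Seq
      h j = ν ^ j * (C j 0 * detᶜ (2 ℕ.+ n) (minor j C))
      h₀ : h 0 ≈ f 1 * E (suc n) (tl w)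
      h₀ = trans (*-identityˡ _) (*-congˡ (detᶜ-cong (2 ℕ.+ n) λ {s} _ r →
        reflexive (≡.cong (λ u → u r) (append-map tl (suc n) (band 1 ∘ suc) (const w) s))))
      h₁ : h 1 ≈ ν * (f 0 * (f 2 * E n (tl (tl w))))
      h₁ = *-cong (*-identityʳ ν) (*-congˡ (trans
        (detᶜ-firstColumn (suc n) (minor 1 C) (λ r → refl))
        (*-congˡ (detᶜ-cong (suc n) {minor 0 (minor 1 C)} {append n (band 1) (const (tl (tl w)))} λ {s} _ r →
          reflexive (≡.cong (λ u → u r) (append-map (tl ∘ tl) n (λ i → band 1 (2 ℕ.+ i)) (const w) s))))))
      middle : ∀ {j} → j < n → h (2 ℕ.+ j) ≈ 0#
      middle {j} j<n = vanish (ν ^ (2 ℕ.+ j))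
        (reflexive (≡.cong (λ u → u 0) (append-left n (λ i → band 1 (2 ℕ.+ i)) (const w) j<n)))
      2+n≡ : 2 ℕ.+ n ≡ (2 ℕ.+ n) ℕ.+ 0
      2+n≡ = ≡.sym (ℕ.+-identityʳ (2 ℕ.+ n))
      column : C (2 ℕ.+ n) 0 ≈ w 0
      column = reflexive (≡.trans (≡.cong (λ t → C t 0) 2+n≡)
        (≡.cong (λ u → u 0) (append-right (2 ℕ.+ n) 0 (band 1) (const w))))
      hᵥ : h (2 ℕ.+ n) ≈ ν ^ (2 ℕ.+ n) * (w 0 * f 2 ^ (2 ℕ.+ n))
      hᵥ = *-congˡ (*-cong column (trans
        (detᶜ-cong (2 ℕ.+ n) λ {s} s<k r → reflexive (≡.trans
          (minor-append (2 ℕ.+ n) 0 (band 1) (const w) 2+n≡ s r)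
          (≡.cong (λ u → u r) (append-left (2 ℕ.+ n) (λ i → tl (band 1 i)) (const (tl w)) s<k))))
        (detᶜ-band₂ (2 ℕ.+ n))))

    -- For the roots α, β of f, both f₂ α and f₂ β solve t² = x t + y.
    x y : Carrier
    x = ν * f 1
    y = ν * (f 0 * f 2)

    U : Seq
    U zero          = 1#
    U (suc zero)    = x
    U (suc (suc k)) = x * U (suc k) + y * U k

    -- For the roots α, β of f, U_k is f₂^k (α^k + α^(k-1) β + ... + β^k), and W_k is
    -- f₂^k (α^k + β^k) when k > 0, but 1 rather than 2 when k = 0.
    W : Seq
    W zero          = 1#
    W (suc zero)    = x
    W (suc (suc k)) = U (suc (suc k)) + y * U k

    -- For V = U or W, the factor f₂^m completes the f₂^k inside V_k to the common factor f₂^n.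
    S : ℕ → Seq → Seq → Carrier
    S n V w = Σᴸ (splits n) λ (k , m) → w k * (f 2 ^ m * V k)

    S-suc : ∀ n V w → S (suc n) V w ≈ w 0 * (f 2 ^ suc n * V 0) + S n (tl V) (tl w)
    S-suc n V w = +-congˡ (reflexive (Σᴸ-map (map₁ suc) (splits n)))

    S-linear : ∀ n {V V₁ V₂} p q w → (∀ k → V k ≈ p * V₁ k + q * V₂ k) →
               S n V w ≈ p * S n V₁ w + q * S n V₂ w
    S-linear n {V} {V₁} {V₂} p q w V≈ = begin
      S n V w
        ≈⟨ Σᴸ-cong (splits n) (λ (k , m) → trans (*-congˡ (*-congˡ (V≈ k)))
             (solve 6 (λ w f p v₁ q v₂ → w :* (f :* (p :* v₁ :+ q :* v₂)) := p :* (w :* (f :* v₁)) :+ q :* (w :* (f :* v₂)))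
               refl (w k) (f 2 ^ m) p (V₁ k) q (V₂ k))) ⟩
      Σᴸ (splits n) (λ (k , m) → p * (w k * (f 2 ^ m * V₁ k)) + q * (w k * (f 2 ^ m * V₂ k)))
        ≈⟨ Σᴸ-+ (splits n) _ _ ⟩
      Σᴸ (splits n) (λ (k , m) → p * (w k * (f 2 ^ m * V₁ k))) + Σᴸ (splits n) (λ (k , m) → q * (w k * (f 2 ^ m * V₂ k)))
        ≈⟨ +-cong (Σᴸ-*ˡ (splits n) p _) (Σᴸ-*ˡ (splits n) q _) ⟨
      p * S n V₁ w + q * S n V₂ w ∎

    -- Once the term with m = 0 is gone, every remaining term has a factor f₂ to give away.
    S-last : ∀ n V w → w (suc n) ≈ 0# → S (suc n) V w ≈ f 2 * S n V w
    S-last zero V w w₁≈0 = begin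
      w 0 * (f 2 * 1# * V 0) + (w 1 * (1# * V 1) + 0#)  ≈⟨ +-congˡ (+-congʳ (*-congʳ w₁≈0)) ⟩
      w 0 * (f 2 * 1# * V 0) + (0# * (1# * V 1) + 0#)
        ≈⟨ solve 4 (λ w₀ f v₀ v₁ → w₀ :* (f :* con 1 :* v₀) :+ (con 0 :* (con 1 :* v₁) :+ con 0)
             := f :* (w₀ :* (con 1 :* v₀) :+ con 0)) refl (w 0) (f 2) (V 0) (V 1) ⟩
      f 2 * (w 0 * (1# * V 0) + 0#) ∎
    S-last (suc n) V w wₙ≈0 = begin
      S (2 ℕ.+ n) V w
        ≈⟨ S-suc (suc n) V w ⟩
      w 0 * (f 2 ^ (2 ℕ.+ n) * V 0) + S (suc n) (tl V) (tl w)
        ≈⟨ +-congˡ (S-last n (tl V) (tl w) wₙ≈0) ⟩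
      w 0 * (f 2 ^ (2 ℕ.+ n) * V 0) + f 2 * S n (tl V) (tl w)
        ≈⟨ solve 5 (λ w₀ f fⁿ v₀ s → w₀ :* (f :* fⁿ :* v₀) :+ f :* s := f :* (w₀ :* (fⁿ :* v₀) :+ s))
             refl (w 0) (f 2) (f 2 ^ suc n) (V 0) (S n (tl V) (tl w)) ⟩
      f 2 * (w 0 * (f 2 ^ suc n * V 0) + S n (tl V) (tl w))
        ≈⟨ *-congˡ (S-suc n V w) ⟨
      f 2 * S (suc n) V w ∎

    νⁿ*νⁿ≈1 : ∀ n → ν ^ n * ν ^ n ≈ 1#
    νⁿ*νⁿ≈1 zero    = *-identityˡ 1#
    νⁿ*νⁿ≈1 (suc n) = begin
      ν * ν ^ n * (ν * ν ^ n)    ≈⟨ solve 2 (λ p q → p :* q :* (p :* q) := p :* p :* (q :* q)) refl ν (ν ^ n) ⟩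
      ν * ν * (ν ^ n * ν ^ n)    ≈⟨ *-cong ν*ν≈1 (νⁿ*νⁿ≈1 n) ⟩
      1# * 1#                    ≈⟨ *-identityˡ 1# ⟩
      1#                         ∎

    -- The recurrence of U carries over to the sum; this is the form that matches `E-suc` after
    -- removal of the signs.
    S-U-step : ∀ n w → S (2 ℕ.+ n) U w ≈
               x * S (suc n) U (tl w) + (y * S n U (tl (tl w)) + w 0 * f 2 ^ (2 ℕ.+ n))
    S-U-step n w = begin
      S (2 ℕ.+ n) U w
        ≈⟨ trans (S-suc (suc n) U w) (+-congˡ (S-suc n (tl U) (tl w))) ⟩
      w 0 * (f 2 ^ (2 ℕ.+ n) * 1#) + (w 1 * (f 2 ^ suc n * x) + S n (tl (tl U)) (tl (tl w)))
        ≈⟨ +-congˡ (+-congˡ (S-linear n x y (tl (tl w)) (λ _ → refl))) ⟩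
      w 0 * (f 2 ^ (2 ℕ.+ n) * 1#) + (w 1 * (f 2 ^ suc n * x) + (x * S n (tl U) (tl (tl w)) + y * S n U (tl (tl w))))
        ≈⟨ solve 8 (λ w₀ p w₁ q x s y t →
             w₀ :* (p :* con 1) :+ (w₁ :* (q :* x) :+ (x :* s :+ y :* t))
               := x :* (w₁ :* (q :* con 1) :+ s) :+ (y :* t :+ w₀ :* p))
             refl (w 0) (f 2 ^ (2 ℕ.+ n)) (w 1) (f 2 ^ suc n) x (S n (tl U) (tl (tl w))) y (S n U (tl (tl w))) ⟩
      x * (w 1 * (f 2 ^ suc n * 1#) + S n (tl U) (tl (tl w))) + (y * S n U (tl (tl w)) + w 0 * f 2 ^ (2 ℕ.+ n))
        ≈⟨ +-congʳ (*-congˡ (S-suc n U (tl w))) ⟨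
      x * S (suc n) U (tl w) + (y * S n U (tl (tl w)) + w 0 * f 2 ^ (2 ℕ.+ n)) ∎

    -- In terms of the roots, the right-hand side is f₂^n times the divided difference of X w(X) at
    -- α and β, where w has the coefficients w₀, ..., w_n. The sign ν^n turns `E-suc` into
    -- `S-U-step`, as ν has square 1.
    E-closed : ∀ n w → ν ^ n * E n w ≈ S n U w
    E-closed zero w = solve 1 (λ w₀ → con 1 :* (con 1 :* (w₀ :* con 1) :+ con 0) := w₀ :* (con 1 :* con 1) :+ con 0)
      refl (w 0)
    E-closed (suc zero) w = begin
      ν * 1# * E 1 w                                    ≈⟨ *-congˡ (E-one w) ⟩
      ν * 1# * (f 1 * w 1 + ν * (w 0 * f 2))
        ≈⟨ solve 5 (λ ν f₁ w₁ w₀ f₂ → ν :* con 1 :* (f₁ :* w₁ :+ ν :* (w₀ :* f₂))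
             := (ν :* ν) :* (w₀ :* f₂) :+ w₁ :* (ν :* f₁)) refl ν (f 1) (w 1) (w 0) (f 2) ⟩
      ν * ν * (w 0 * f 2) + w 1 * (ν * f 1)             ≈⟨ +-congʳ (*-congʳ ν*ν≈1) ⟩
      1# * (w 0 * f 2) + w 1 * (ν * f 1)
        ≈⟨ solve 4 (λ w₀ f₂ w₁ x → con 1 :* (w₀ :* f₂) :+ w₁ :* x
             := w₀ :* (f₂ :* con 1 :* con 1) :+ (w₁ :* (con 1 :* x) :+ con 0)) refl (w 0) (f 2) (w 1) x ⟩
      S 1 U w                                           ∎
    E-closed (suc (suc n)) w = begin
      ν ^ (2 ℕ.+ n) * E (2 ℕ.+ n) w
        ≈⟨ *-congˡ (E-suc n w) ⟩
      ν * (ν * N) * (f 1 * E₁ + (ν * (f 0 * (f 2 * E₂)) + ν * (ν * N) * (w 0 * F)))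
        ≈⟨ solve 9 (λ ν N f₁ E₁ f₀ f₂ E₂ w₀ F →
             ν :* (ν :* N) :* (f₁ :* E₁ :+ (ν :* (f₀ :* (f₂ :* E₂)) :+ ν :* (ν :* N) :* (w₀ :* F)))
               := ν :* f₁ :* (ν :* N :* E₁)
                  :+ (ν :* ν :* (ν :* (f₀ :* f₂) :* (N :* E₂)) :+ ν :* (ν :* N) :* (ν :* (ν :* N)) :* (w₀ :* F)))
             refl ν N (f 1) E₁ (f 0) (f 2) E₂ (w 0) F ⟩
      x * (ν * N * E₁) + (ν * ν * (y * (N * E₂)) + ν * (ν * N) * (ν * (ν * N)) * (w 0 * F))
        ≈⟨ +-congˡ (+-cong (trans (*-congʳ ν*ν≈1) (*-identityˡ _)) (trans (*-congʳ (νⁿ*νⁿ≈1 (2 ℕ.+ n))) (*-identityˡ _))) ⟩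
      x * (ν * N * E₁) + (y * (N * E₂) + w 0 * F)
        ≈⟨ +-cong (*-congˡ (E-closed (suc n) (tl w))) (+-congʳ (*-congˡ (E-closed n (tl (tl w))))) ⟩
      x * S (suc n) U (tl w) + (y * S n U (tl (tl w)) + w 0 * F)
        ≈⟨ S-U-step n w ⟨
      S (2 ℕ.+ n) U w ∎
      where
      N E₁ E₂ F : Carrier
      N  = ν ^ n
      E₁ = E (suc n) (tl w)
      E₂ = E n (tl (tl w))
      F  = f 2 ^ (2 ℕ.+ n)

    -- W differs from U by y = ν f₀ f₂ times the value of U two places earlier. The factor f₂ of y
    -- is absorbed by `S-last`, for which the coefficient beyond the top must vanish.
    S-W : ∀ n u → u (2 ℕ.+ n) ≈ 0# → S (suc n) W u ≈ S (suc n) U u + ν * f 0 * S n U (tl (tl u))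
    S-W zero u u₂≈0 = sym (trans
      (+-congˡ (trans (*-congˡ (trans (+-identityʳ _) (trans (*-congʳ u₂≈0) (zeroˡ _)))) (zeroʳ _)))
      (+-identityʳ _))
    S-W (suc n) u uₙ≈0 = begin
      S (2 ℕ.+ n) W u
        ≈⟨ trans (S-suc (suc n) W u) (+-congˡ (S-suc n (tl W) (tl u))) ⟩
      u 0 * (f 2 ^ (2 ℕ.+ n) * 1#) + (u 1 * (f 2 ^ suc n * x) + S n (tl (tl W)) (tl (tl u)))
        ≈⟨ +-congˡ (+-congˡ (S-linear n 1# y (tl (tl u)) (λ k → +-congʳ (sym (*-identityˡ _))))) ⟩
      u 0 * (f 2 ^ (2 ℕ.+ n) * 1#) + (u 1 * (f 2 ^ suc n * x) + (1# * S n (tl (tl U)) (tl (tl u)) + y * S n U (tl (tl u))))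
        ≈⟨ solve 7 (λ p q s ν f₀ f₂ t → p :+ (q :+ (con 1 :* s :+ ν :* (f₀ :* f₂) :* t))
             := (p :+ (q :+ s)) :+ ν :* f₀ :* (f₂ :* t))
             refl (u 0 * (f 2 ^ (2 ℕ.+ n) * 1#)) (u 1 * (f 2 ^ suc n * x)) (S n (tl (tl U)) (tl (tl u)))
             ν (f 0) (f 2) (S n U (tl (tl u))) ⟩
      u 0 * (f 2 ^ (2 ℕ.+ n) * 1#) + (u 1 * (f 2 ^ suc n * x) + S n (tl (tl U)) (tl (tl u)))
        + ν * f 0 * (f 2 * S n U (tl (tl u)))
        ≈⟨ +-cong (trans (S-suc (suc n) U u) (+-congˡ (S-suc n (tl U) (tl u)))) (*-congˡ (S-last n U (tl (tl u)) uₙ≈0)) ⟨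
      S (2 ℕ.+ n) U u + ν * f 0 * S (suc n) U (tl (tl u)) ∎

    -- In terms of the roots this is f₂^n g(α) g(β) for the polynomial g with coefficients u₀, ...,
    -- u_n, its products u_i u_(i+k) grouped by the smaller index i.
    P : ℕ → Seq → Carrier
    P n u = Σᴸ (splits n) λ (i , n′) → f 0 ^ i * (u i * S n′ W (λ k → u (i ℕ.+ k)))

    P-suc : ∀ n u → P (suc n) u ≈ u 0 * S (suc n) W u + f 0 * P n (tl u)
    P-suc n u = +-cong (*-identityˡ _) (begin
      Σᴸ (List.map (map₁ suc) (splits n)) _
        ≡⟨ Σᴸ-map (map₁ suc) (splits n) ⟩
      Σᴸ (splits n) (λ (i , n′) → f 0 * f 0 ^ i * (u (suc i) * S n′ W (λ k → u (suc i ℕ.+ k))))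
        ≈⟨ Σᴸ-cong (splits n) (λ _ → *-assoc (f 0) _ _) ⟩
      Σᴸ (splits n) (λ (i , n′) → f 0 * (f 0 ^ i * (u (suc i) * S n′ W (λ k → u (suc i ℕ.+ k)))))
        ≈⟨ Σᴸ-*ˡ (splits n) (f 0) _ ⟨
      f 0 * P n (tl u) ∎)

    -- B 1 is B 0 shifted down by one row below an arbitrary top entry, which is 0 in the Sylvester matrix
    -- but not in its minors.
    D-closed : ∀ n (B : ℕ → Seq) → tl (B 1) ≡ B 0 → B 0 (suc n) ≈ 0# →
               D n B ≈ P n (B 0) + ν ^ suc n * (B 1 0 * E n (tl (B 0)))
    D-closed zero B tlB₁≡B₀ _ = begin
      D 0 B
        ≈⟨ D-zero B ⟩
      B 0 0 * E 0 (tl (B 1)) + ν * (B 1 0 * E 0 (tl (B 0)))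
        ≡⟨ ≡.cong (λ v → B 0 0 * E 0 v + ν * (B 1 0 * E 0 (tl (B 0)))) tlB₁≡B₀ ⟩
      B 0 0 * E 0 (B 0) + ν * (B 1 0 * E 0 (tl (B 0)))
        ≈⟨ solve 4 (λ u₀ ν v₀ e → u₀ :* (con 1 :* (u₀ :* con 1) :+ con 0) :+ ν :* (v₀ :* e)
             := (con 1 :* (u₀ :* (u₀ :* (con 1 :* con 1) :+ con 0)) :+ con 0) :+ ν :* con 1 :* (v₀ :* e))
             refl (B 0 0) ν (B 1 0) (E 0 (tl (B 0))) ⟩
      P 0 (B 0) + ν * 1# * (B 1 0 * E 0 (tl (B 0))) ∎
    D-closed (suc n) B tlB₁≡B₀ uₙ≈0 = begin
      D (suc n) B
        ≈⟨ D-suc n B ⟩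
      f 0 * D n (tl ∘ B) + (N * (u 0 * E (suc n) (tl (B 1))) + Q)
        ≡⟨ ≡.cong (λ v → f 0 * D n (tl ∘ B) + (N * (u 0 * E (suc n) v) + Q)) tlB₁≡B₀ ⟩
      f 0 * D n (tl ∘ B) + (N * (u 0 * E (suc n) u) + Q)
        ≈⟨ +-congʳ (*-congˡ (D-closed n (tl ∘ B) (≡.cong tl tlB₁≡B₀) uₙ≈0)) ⟩
      f 0 * (P n (tl u) + N * (B 1 1 * E n (tl (tl u)))) + (N * (u 0 * E (suc n) u) + Q)
        ≡⟨ ≡.cong (λ v → f 0 * (P n (tl u) + N * (v 0 * E n (tl (tl u)))) + (N * (u 0 * E (suc n) u) + Q)) tlB₁≡B₀ ⟩
      f 0 * (P n (tl u) + N * (u 0 * E n (tl (tl u)))) + (N * (u 0 * E (suc n) u) + Q)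
        -- The correction left by the smaller determinant and the contribution of the first g-column
        -- share the factor u₀. Together they form the right-hand side of `S-W`: this is where
        -- complete homogeneous sums turn into power sums.
        ≈⟨ solve 8 (λ f₀ p ν νⁿ u₀ e e′ q →
             f₀ :* (p :+ ν :* νⁿ :* (u₀ :* e)) :+ (ν :* νⁿ :* (u₀ :* e′) :+ q)
               := u₀ :* (ν :* νⁿ :* e′ :+ ν :* f₀ :* (νⁿ :* e)) :+ f₀ :* p :+ q)
             refl (f 0) (P n (tl u)) ν (ν ^ n) (u 0) (E n (tl (tl u))) (E (suc n) u) Q ⟩
      u 0 * (N * E (suc n) u + ν * f 0 * (ν ^ n * E n (tl (tl u)))) + f 0 * P n (tl u) + Q
        ≈⟨ +-congʳ (+-congʳ (*-congˡ (+-cong (E-closed (suc n) u) (*-congˡ (E-closed n (tl (tl u))))))) ⟩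
      u 0 * (S (suc n) U u + ν * f 0 * S n U (tl (tl u))) + f 0 * P n (tl u) + Q
        ≈⟨ +-congʳ (+-congʳ (*-congˡ (S-W n u uₙ≈0))) ⟨
      u 0 * S (suc n) W u + f 0 * P n (tl u) + Q
        ≈⟨ +-congʳ (P-suc n u) ⟨
      P (suc n) u + Q ∎
      where
      u : Seq
      u = B 0
      N Q : Carrier
      N = ν ^ suc n
      Q = ν ^ suc (suc n) * (B 1 0 * E (suc n) (tl u))

    entry-end : ∀ {k} (a : Vector Carrier k) → entry a k ≡ 0#
    entry-end {zero}  a = ≡.refl
    entry-end {suc k} a = entry-end (λ l → a (suc l))

    Res-closed : ∀ {n} (g : Vector Carrier (suc n)) → Res {2} {n} φ g ≈ P n (entry g)
    Res-closed {n} g = begin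
      det {n ℕ.+ 2} (sylvester {2} {n} φ g)
        ≈⟨ det-cong (λ r s → reflexive (≡.trans
             (splitAt-append n (λ j → band 0 j (toℕ r)) (λ j → B j (toℕ r)) s)
             (≡.sym (append-map (λ u → u (toℕ r)) n (band 0) B (toℕ s))))) ⟩
      detᶜ (n ℕ.+ 2) (append n (band 0) B)
        ≡⟨ ≡.cong (λ k → detᶜ k (append n (band 0) B)) (ℕ.+-comm n 2) ⟩
      D n B
        ≈⟨ D-closed n B ≡.refl (reflexive (entry-end g)) ⟩
      P n (entry g) + ν ^ suc n * (0# * E n (tl (entry g)))
        ≈⟨ trans (+-congˡ (vanish _ refl)) (+-identityʳ _) ⟩
      P n (entry g) ∎
      where
      B : ℕ → Seq
      B j = shiftDown j (entry g)

    -- Explicit coefficients of U and W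

    T : (ℕ → ℕ → ℕ) → Seq
    T c k = Σᴸ (splits₂ k) λ (a , b) → c a b × (x ^ b * y ^ a)

    T-suc-suc : ∀ c k → T c (2 ℕ.+ k) ≈
                c 0 (2 ℕ.+ k) × (x ^ (2 ℕ.+ k) * 1#) + Σᴸ (splits₂ k) λ (a , b) → c (suc a) b × (x ^ b * y ^ suc a)
    T-suc-suc c k = +-congˡ (reflexive (Σᴸ-map (map₁ suc) (splits₂ k)))

    -- Multiplication by x moves a coefficient from x^b to x^(b+1), and nothing arrives at x^0.
    shiftʳ : (ℕ Product.× ℕ → Carrier) → ℕ Product.× ℕ → Carrier
    shiftʳ h (a , zero)  = 0#
    shiftʳ h (a , suc b) = h (a , b)

    Σᴸ-shiftʳ : ∀ k h → Σᴸ (splits₂ (suc k)) (shiftʳ h) ≈ Σᴸ (splits₂ k) h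
    Σᴸ-shiftʳ zero          h = refl
    Σᴸ-shiftʳ (suc zero)    h = +-congˡ (+-identityˡ 0#)
    Σᴸ-shiftʳ (suc (suc k)) h = +-congˡ (begin
      Σᴸ (List.map (map₁ suc) (splits₂ (suc k))) (shiftʳ h)  ≡⟨ Σᴸ-map (map₁ suc) (splits₂ (suc k)) ⟩
      Σᴸ (splits₂ (suc k)) (shiftʳ h ∘ map₁ suc)
        ≈⟨ Σᴸ-cong (splits₂ (suc k)) (λ { (a , zero) → refl ; (a , suc b) → refl }) ⟩
      Σᴸ (splits₂ (suc k)) (shiftʳ (h ∘ map₁ suc))           ≈⟨ Σᴸ-shiftʳ k (h ∘ map₁ suc) ⟩
      Σᴸ (splits₂ k) (h ∘ map₁ suc)                          ≡⟨ Σᴸ-map (map₁ suc) (splits₂ k) ⟨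
      Σᴸ (List.map (map₁ suc) (splits₂ k)) h                 ∎)

    binomTerm : ℕ Product.× ℕ → Carrier
    binomTerm (a , b) = binom a b × (x ^ b * y ^ a)

    binomTerm-pascal : ∀ ((a , b) : ℕ Product.× ℕ) →
                       binomTerm (suc a , b) ≈ x * shiftʳ binomTerm (suc a , b) + y * binomTerm (a , b)
    binomTerm-pascal (a , zero) = begin
      1 × (1# * (y * y ^ a))             ≈⟨ ×-congʳ 1 (solve 2 (λ y z → con 1 :* (y :* z) := y :* (con 1 :* z)) refl y (y ^ a)) ⟩
      1 × (y * (1# * y ^ a))             ≈⟨ ×-comm-* 1 y (1# * y ^ a) ⟨
      y * (1 × (1# * y ^ a))             ≡⟨ ≡.cong (λ c → y * (c × (1# * y ^ a))) (binom-zeroʳ a) ⟨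
      y * (binom a 0 × (1# * y ^ a))     ≈⟨ trans (+-congʳ (zeroʳ x)) (+-identityˡ _) ⟨
      x * 0# + y * (binom a 0 × (1# * y ^ a))  ∎
    binomTerm-pascal (a , suc b) = begin
      (c₁ ℕ.+ c₂) × (x * x ^ b * (y * y ^ a))
        ≈⟨ ×-homo-+ (x * x ^ b * (y * y ^ a)) c₁ c₂ ⟩
      c₁ × (x * x ^ b * (y * y ^ a)) + c₂ × (x * x ^ b * (y * y ^ a))
        ≈⟨ +-comm _ _ ⟩
      c₂ × (x * x ^ b * (y * y ^ a)) + c₁ × (x * x ^ b * (y * y ^ a))
        ≈⟨ +-cong (×-congʳ c₂ (*-assoc x _ _)) (×-congʳ c₁ (solve 3 (λ s y z → s :* (y :* z) := y :* (s :* z)) refl (x * x ^ b) y (y ^ a))) ⟩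
      c₂ × (x * (x ^ b * (y * y ^ a))) + c₁ × (y * (x * x ^ b * y ^ a))
        ≈⟨ +-cong (×-comm-* c₂ x _) (×-comm-* c₁ y _) ⟨
      x * (c₂ × (x ^ b * (y * y ^ a))) + y * (c₁ × (x * x ^ b * y ^ a))  ∎
      where
      c₁ c₂ : ℕ
      c₁ = binom a (suc b)
      c₂ = binom (suc a) b

    -- U_k is the sum of all words of weight k in the letters x and y, and `binom a b` counts those
    -- with a letters y and b letters x. Pascal's rule sorts them by their first letter.
    U-closed : ∀ k → U k ≈ T binom k
    U-closed zero          = solve 0 (con 1 := (con 1 :* con 1 :+ con 0) :+ con 0) refl
    U-closed (suc zero)    = solve 1 (λ x → x := (x :* con 1 :* con 1 :+ con 0) :+ con 0) refl x
    U-closed (suc (suc k)) = begin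
      x * U (suc k) + y * U k
        ≈⟨ +-cong (*-congˡ (U-closed (suc k))) (*-congˡ (U-closed k)) ⟩
      x * T binom (suc k) + y * T binom k
        ≈⟨ +-cong (*-congˡ (sym (Σᴸ-shiftʳ (suc k) binomTerm))) (Σᴸ-*ˡ (splits₂ k) y _) ⟩
      x * (binomTerm (0 , suc k) + Σᴸ (List.map (map₁ suc) (splits₂ k)) (shiftʳ binomTerm)) + Y
        ≡⟨ ≡.cong (λ s → x * (binomTerm (0 , suc k) + s) + Y) (Σᴸ-map (map₁ suc) (splits₂ k)) ⟩
      x * (binomTerm (0 , suc k) + Z) + Y
        ≈⟨ solve 4 (λ x t z y → x :* ((t :* con 1 :+ con 0) :+ z) :+ y := (x :* t :* con 1 :+ con 0) :+ (x :* z :+ y))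
             refl x (x ^ suc k) Z Y ⟩
      binomTerm (0 , 2 ℕ.+ k) + (x * Z + Y)
        ≈⟨ +-congˡ (+-congʳ (Σᴸ-*ˡ (splits₂ k) x _)) ⟩
      binomTerm (0 , 2 ℕ.+ k) + (Σᴸ (splits₂ k) (λ t → x * shiftʳ binomTerm (map₁ suc t)) + Y)
        ≈⟨ +-congˡ (Σᴸ-+ (splits₂ k) _ _) ⟨
      binomTerm (0 , 2 ℕ.+ k) + Σᴸ (splits₂ k) (λ t → x * shiftʳ binomTerm (map₁ suc t) + y * binomTerm t)
        ≈⟨ +-congˡ (Σᴸ-cong (splits₂ k) binomTerm-pascal) ⟨
      binomTerm (0 , 2 ℕ.+ k) + Σᴸ (splits₂ k) (binomTerm ∘ map₁ suc)
        ≈⟨ T-suc-suc binom k ⟨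
      T binom (2 ℕ.+ k) ∎
      where
      Y Z : Carrier
      Y = Σᴸ (splits₂ k) (λ t → y * binomTerm t)
      Z = Σᴸ (splits₂ k) (shiftʳ binomTerm ∘ map₁ suc)

    W-closed : ∀ k → W k ≈ T lucas k
    W-closed zero          = U-closed 0
    W-closed (suc zero)    = U-closed 1
    W-closed (suc (suc k)) = begin
      U (2 ℕ.+ k) + y * U k
        ≈⟨ +-cong (trans (U-closed (2 ℕ.+ k)) (T-suc-suc binom k)) (trans (*-congˡ (U-closed k)) (Σᴸ-*ˡ (splits₂ k) y _)) ⟩
      binomTerm (0 , 2 ℕ.+ k) + Σᴸ (splits₂ k) (binomTerm ∘ map₁ suc) + Σᴸ (splits₂ k) (λ t → y * binomTerm t)
        ≈⟨ +-assoc _ _ _ ⟩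
      binomTerm (0 , 2 ℕ.+ k) + (Σᴸ (splits₂ k) (binomTerm ∘ map₁ suc) + Σᴸ (splits₂ k) (λ t → y * binomTerm t))
        ≈⟨ +-congˡ (Σᴸ-+ (splits₂ k) _ _) ⟨
      binomTerm (0 , 2 ℕ.+ k) + Σᴸ (splits₂ k) (λ t → binomTerm (map₁ suc t) + y * binomTerm t)
        ≈⟨ +-congˡ (Σᴸ-cong (splits₂ k) merge) ⟩
      binomTerm (0 , 2 ℕ.+ k) + Σᴸ (splits₂ k) (λ (a , b) → lucas (suc a) b × (x ^ b * y ^ suc a))
        ≈⟨ T-suc-suc lucas k ⟨
      T lucas (2 ℕ.+ k) ∎
      where
      merge : ∀ ((a , b) : ℕ Product.× ℕ) →
              binomTerm (suc a , b) + y * binomTerm (a , b) ≈ lucas (suc a) b × (x ^ b * y ^ suc a)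
      merge (a , b) = begin
        c₁ × (x ^ b * y ^ suc a) + y * (c₂ × (x ^ b * y ^ a))  ≈⟨ +-congˡ (×-comm-* c₂ y _) ⟩
        c₁ × (x ^ b * y ^ suc a) + c₂ × (y * (x ^ b * y ^ a))
          ≈⟨ +-congˡ (×-congʳ c₂ (solve 3 (λ s y z → y :* (s :* z) := s :* (y :* z)) refl (x ^ b) y (y ^ a))) ⟩
        c₁ × (x ^ b * y ^ suc a) + c₂ × (x ^ b * y ^ suc a)    ≈⟨ ×-homo-+ (x ^ b * y ^ suc a) c₁ c₂ ⟨
        (c₁ ℕ.+ c₂) × (x ^ b * y ^ suc a)                      ∎
        where
        c₁ c₂ : ℕ
        c₁ = binom (suc a) b
        c₂ = binom a b

    module _ {n} (g : Vector Carrier (suc n)) where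

      term : ℕ → ℕ Product.× ℕ → ℕ Product.× ℕ → Carrier
      term i (k , m) (a , b) =
        f 0 ^ i * (entry g i * (entry g (i ℕ.+ k) * (f 2 ^ m * (lucas a b × (x ^ b * y ^ a)))))

      Res-expansion : Res {2} {n} φ g ≈
        Σᴸ (splits n) λ (i , n′) → Σᴸ (splits n′) λ (k , m) → Σᴸ (splits₂ k) (term i (k , m))
      Res-expansion = trans (Res-closed {n} g) (Σᴸ-cong (splits n) λ (i , n′) → begin
        f 0 ^ i * (G i * S n′ W (λ k → G (i ℕ.+ k)))
          ≈⟨ *-congˡ (Σᴸ-*ˡ (splits n′) (G i) _) ⟩
        f 0 ^ i * Σᴸ (splits n′) (λ (k , m) → G i * (G (i ℕ.+ k) * (f 2 ^ m * W k)))
          ≈⟨ Σᴸ-*ˡ (splits n′) (f 0 ^ i) _ ⟩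
        Σᴸ (splits n′) (λ (k , m) → f 0 ^ i * (G i * (G (i ℕ.+ k) * (f 2 ^ m * W k))))
          ≈⟨ Σᴸ-cong (splits n′) (λ (k , m) → pushIn i k m) ⟩
        Σᴸ (splits n′) (λ (k , m) → Σᴸ (splits₂ k) (term i (k , m))) ∎)
        where
        G : Seq
        G = entry g
        pushIn : ∀ i k m → f 0 ^ i * (G i * (G (i ℕ.+ k) * (f 2 ^ m * W k))) ≈ Σᴸ (splits₂ k) (term i (k , m))
        pushIn i k m = begin
          f 0 ^ i * (G i * (G (i ℕ.+ k) * (f 2 ^ m * W k)))
            ≈⟨ *-congˡ (*-congˡ (*-congˡ (*-congˡ (W-closed k)))) ⟩
          f 0 ^ i * (G i * (G (i ℕ.+ k) * (f 2 ^ m * T lucas k)))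
            ≈⟨ *-congˡ (*-congˡ (*-congˡ (Σᴸ-*ˡ (splits₂ k) (f 2 ^ m) _))) ⟩
          f 0 ^ i * (G i * (G (i ℕ.+ k) * Σᴸ (splits₂ k) _))
            ≈⟨ *-congˡ (*-congˡ (Σᴸ-*ˡ (splits₂ k) (G (i ℕ.+ k)) _)) ⟩
          f 0 ^ i * (G i * Σᴸ (splits₂ k) _)
            ≈⟨ *-congˡ (Σᴸ-*ˡ (splits₂ k) (G i) _) ⟩
          f 0 ^ i * Σᴸ (splits₂ k) _
            ≈⟨ Σᴸ-*ˡ (splits₂ k) (f 0 ^ i) _ ⟩
          Σᴸ (splits₂ k) (term i (k , m)) ∎

open ≡ using (refl; cong; cong₂; sym; trans; subst; subst₂)

-- Polynomials as formal sums of terms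

module _ {k : ℕ} where

  open RawRing (polyRing k) public using () renaming (_*_ to _⊗_; _≈_ to _≈ᴾ_; -_ to ⊝_)

  1ᴹ : Monomial k
  1ᴹ = replicate k 0

  ·-cancelˡ : ∀ {l} (α β γ : Monomial l) → α · β ≡ α · γ → β ≡ γ
  ·-cancelˡ []      []      []      _  = refl
  ·-cancelˡ (a ∷ α) (b ∷ β) (c ∷ γ) eq = cong₂ _∷_
    (ℕ.+-cancelˡ-≡ a b c (Vec.∷-injectiveˡ eq)) (·-cancelˡ α β γ (Vec.∷-injectiveʳ eq))

  divides? : ∀ {l} (β α : Monomial l) → (∃[ γ ] β · γ ≡ α) ⊎ (∀ γ → β · γ ≢ α)
  divides? []      []      = inj₁ ([] , refl)
  divides? (b ∷ β) (a ∷ α) with b ℕ.≤? a | divides? β α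
  ... | yes b≤a | inj₁ (γ , eq) = inj₁ (a ℕ.∸ b ∷ γ , cong₂ _∷_ (ℕ.m+[n∸m]≡n b≤a) eq)
  ... | yes _   | inj₂ ∄γ       = inj₂ λ { (c ∷ γ) eq → ∄γ γ (Vec.∷-injectiveʳ eq) }
  ... | no b≰a  | _             = inj₂ λ { (c ∷ γ) eq → b≰a (subst (b ℕ.≤_) (Vec.∷-injectiveˡ eq) (ℕ.m≤m+n b c)) }

  termCoeff : ℤ Product.× Monomial k → Monomial k → ℤ
  termCoeff (c , β) α = if does (Vec.≡-dec ℕ._≟_ β α) then c else 0ℤ

  coeff-++ : ∀ (P Q : Poly k) α → coeff (P ++ Q) α ≡ coeff P α ℤ.+ coeff Q α
  coeff-++ []      Q α = sym (ℤ.+-identityˡ _)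
  coeff-++ (t ∷ P) Q α = trans (cong (ℤ._+_ (termCoeff t α)) (coeff-++ P Q α)) (sym (ℤ.+-assoc (termCoeff t α) (coeff P α) (coeff Q α)))

  coeff-⊝ : ∀ (P : Poly k) α → coeff (⊝ P) α ≡ ℤ.- coeff P α
  coeff-⊝ []            α = refl
  coeff-⊝ ((c , β) ∷ P) α with Vec.≡-dec ℕ._≟_ β α
  ... | yes _ = trans (cong (ℤ._+_ (ℤ.- c)) (coeff-⊝ P α)) (sym (ℤ.neg-distrib-+ c (coeff P α)))
  ... | no _  = trans (cong (ℤ._+_ 0ℤ) (coeff-⊝ P α)) (sym (ℤ.neg-distrib-+ 0ℤ (coeff P α)))

  infixr 7 _∙ᵗ_

  _∙ᵗ_ : ℤ Product.× Monomial k → Poly k → Poly k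
  (c , β) ∙ᵗ Q = List.map (λ (d , γ) → c ℤ.* d , β · γ) Q

  coeff-∙ᵗ : ∀ c β Q γ → coeff ((c , β) ∙ᵗ Q) (β · γ) ≡ c ℤ.* coeff Q γ
  coeff-∙ᵗ c β []            γ = sym (ℤ.*-zeroʳ c)
  coeff-∙ᵗ c β ((d , δ) ∷ Q) γ with Vec.≡-dec ℕ._≟_ (β · δ) (β · γ) | Vec.≡-dec ℕ._≟_ δ γ
  ... | yes _ | yes _   = trans (cong (ℤ._+_ (c ℤ.* d)) (coeff-∙ᵗ c β Q γ)) (sym (ℤ.*-distribˡ-+ c d (coeff Q γ)))
  ... | no _  | no _    = trans (ℤ.+-identityˡ _) (trans (coeff-∙ᵗ c β Q γ) (cong (c ℤ.*_) (sym (ℤ.+-identityˡ _))))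
  ... | yes p | no δ≢γ  = contradiction (·-cancelˡ β δ γ p) δ≢γ
  ... | no ¬p | yes δ≡γ = contradiction (cong (β ·_) δ≡γ) ¬p

  coeff-∙ᵗ-∤ : ∀ c {β α} Q → (∀ γ → β · γ ≢ α) → coeff ((c , β) ∙ᵗ Q) α ≡ 0ℤ
  coeff-∙ᵗ-∤ c         []            ∤ = refl
  coeff-∙ᵗ-∤ c {β} {α} ((d , δ) ∷ Q) ∤ with Vec.≡-dec ℕ._≟_ (β · δ) α
  ... | yes p = contradiction p (∤ δ)
  ... | no _  = trans (ℤ.+-identityˡ _) (coeff-∙ᵗ-∤ c Q ∤)

  -- Lists with equal coefficients need not be equal, so the coefficient at α is computed: c times
  -- the one at the quotient of α by β, or 0 if β does not divide α.
  ∙ᵗ-cong : ∀ t {P Q} → P ≈ᴾ Q → t ∙ᵗ P ≈ᴾ t ∙ᵗ Q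
  ∙ᵗ-cong (c , β) {P} {Q} P≈Q α with divides? β α
  ... | inj₁ (γ , refl) = trans (coeff-∙ᵗ c β P γ) (trans (cong (c ℤ.*_) (P≈Q γ)) (sym (coeff-∙ᵗ c β Q γ)))
  ... | inj₂ ∤          = trans (coeff-∙ᵗ-∤ c P ∤) (sym (coeff-∙ᵗ-∤ c Q ∤))

  ++-cong : ∀ {P P′ Q Q′ : Poly k} → P ≈ᴾ P′ → Q ≈ᴾ Q′ → (P ++ Q) ≈ᴾ (P′ ++ Q′)
  ++-cong {P} {P′} {Q} {Q′} p q α = begin
    coeff (P ++ Q) α           ≡⟨ coeff-++ P Q α ⟩
    coeff P α ℤ.+ coeff Q α    ≡⟨ cong₂ ℤ._+_ (p α) (q α) ⟩
    coeff P′ α ℤ.+ coeff Q′ α  ≡⟨ coeff-++ P′ Q′ α ⟨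
    coeff (P′ ++ Q′) α         ∎
    where open ≡-Reasoning

  ++-comm : ∀ (P Q : Poly k) → (P ++ Q) ≈ᴾ (Q ++ P)
  ++-comm P Q α = trans (coeff-++ P Q α) (trans (ℤ.+-comm (coeff P α) (coeff Q α)) (sym (coeff-++ Q P α)))

  ≈ᴾ-reflexive : ∀ {P Q : Poly k} → P ≡ Q → P ≈ᴾ Q
  ≈ᴾ-reflexive P≡Q α = cong (λ P → coeff P α) P≡Q

  ·-comm : ∀ {l} (α β : Monomial l) → α · β ≡ β · α
  ·-comm = Vec.zipWith-comm ℕ.+-comm

  ·-assoc : ∀ {l} (α β γ : Monomial l) → (α · β) · γ ≡ α · (β · γ)
  ·-assoc = Vec.zipWith-assoc ℕ.+-assoc

  ·-identityˡ : ∀ {l} (α : Monomial l) → replicate l 0 · α ≡ α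
  ·-identityˡ = Vec.zipWith-identityˡ ℕ.+-identityˡ

  ⊗-congˡ : ∀ P {Q Q′ : Poly k} → Q ≈ᴾ Q′ → P ⊗ Q ≈ᴾ P ⊗ Q′
  ⊗-congˡ []      Q≈Q′ α = refl
  ⊗-congˡ (t ∷ P) {Q} {Q′} Q≈Q′ = ++-cong {t ∙ᵗ Q} {t ∙ᵗ Q′} {P ⊗ Q} {P ⊗ Q′} (∙ᵗ-cong t {Q} {Q′} Q≈Q′) (⊗-congˡ P Q≈Q′)

  ⊗-zeroʳ : ∀ (P : Poly k) → P ⊗ [] ≡ []
  ⊗-zeroʳ []      = refl
  ⊗-zeroʳ (t ∷ P) = ⊗-zeroʳ P

  -- The product recurses on its left factor. This is the corresponding rule for the right factor,
  -- valid only up to the order of the terms, and it drives the induction for commutativity.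
  ⊗-∷ : ∀ Q t (P : Poly k) → Q ⊗ (t ∷ P) ≈ᴾ t ∙ᵗ Q ++ Q ⊗ P
  ⊗-∷ []            t       P α = refl
  ⊗-∷ ((d , δ) ∷ Q) (c , γ) P α = begin
    e₁ ℤ.+ coeff (s ∙ᵗ P ++ Q ⊗ ((c , γ) ∷ P)) α
      ≡⟨ cong (ℤ._+_ e₁) (trans (coeff-++ (s ∙ᵗ P) _ α) (cong (ℤ._+_ x) (trans (⊗-∷ Q (c , γ) P α) (coeff-++ ((c , γ) ∙ᵗ Q) (Q ⊗ P) α)))) ⟩
    e₁ ℤ.+ (x ℤ.+ (y ℤ.+ z))
      ≡⟨ cong (ℤ._+ (x ℤ.+ (y ℤ.+ z))) (cong₂ (λ e ε → termCoeff (e , ε) α) (ℤ.*-comm d c) (·-comm δ γ)) ⟩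
    e₂ ℤ.+ (x ℤ.+ (y ℤ.+ z))
      ≡⟨ rearrange e₂ x y z ⟩
    e₂ ℤ.+ (y ℤ.+ (x ℤ.+ z))
      ≡⟨ cong (ℤ._+_ e₂) (trans (coeff-++ ((c , γ) ∙ᵗ Q) _ α) (cong (ℤ._+_ y) (coeff-++ (s ∙ᵗ P) (Q ⊗ P) α))) ⟨
    e₂ ℤ.+ coeff ((c , γ) ∙ᵗ Q ++ (s ∙ᵗ P ++ Q ⊗ P)) α ∎
    where
    open ≡-Reasoning
    s = (d , δ)
    e₁ = termCoeff (d ℤ.* c , δ · γ) α
    e₂ = termCoeff (c ℤ.* d , γ · δ) α
    x = coeff (s ∙ᵗ P) α
    y = coeff ((c , γ) ∙ᵗ Q) α
    z = coeff (Q ⊗ P) α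
    rearrange : ∀ e x y z → e ℤ.+ (x ℤ.+ (y ℤ.+ z)) ≡ e ℤ.+ (y ℤ.+ (x ℤ.+ z))
    rearrange = ℤ-Solver.solve-∀

  ⊗-comm : ∀ (P Q : Poly k) → P ⊗ Q ≈ᴾ Q ⊗ P
  ⊗-comm []      Q α = ≈ᴾ-reflexive (sym (⊗-zeroʳ Q)) α
  ⊗-comm (t ∷ P) Q α = trans
    (++-cong {t ∙ᵗ Q} {t ∙ᵗ Q} {P ⊗ Q} {Q ⊗ P} (λ _ → refl) (⊗-comm P Q) α)
    (sym (⊗-∷ Q t P α))

  ⊗-cong : ∀ {P P′ Q Q′ : Poly k} → P ≈ᴾ P′ → Q ≈ᴾ Q′ → P ⊗ Q ≈ᴾ P′ ⊗ Q′
  ⊗-cong {P} {P′} {Q} {Q′} P≈P′ Q≈Q′ α = begin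
    coeff (P ⊗ Q) α    ≡⟨ ⊗-congˡ P Q≈Q′ α ⟩
    coeff (P ⊗ Q′) α   ≡⟨ ⊗-comm P Q′ α ⟩
    coeff (Q′ ⊗ P) α   ≡⟨ ⊗-congˡ Q′ P≈P′ α ⟩
    coeff (Q′ ⊗ P′) α  ≡⟨ ⊗-comm Q′ P′ α ⟩
    coeff (P′ ⊗ Q′) α  ∎
    where open ≡-Reasoning

  ⊗-distribʳ-++ : ∀ (P Q S : Poly k) → (P ++ Q) ⊗ S ≡ P ⊗ S ++ Q ⊗ S
  ⊗-distribʳ-++ []      Q S = refl
  ⊗-distribʳ-++ (t ∷ P) Q S = trans (cong (t ∙ᵗ S ++_) (⊗-distribʳ-++ P Q S)) (sym (List.++-assoc (t ∙ᵗ S) (P ⊗ S) (Q ⊗ S)))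

  ∙ᵗ-⊗ : ∀ t (Q S : Poly k) → (t ∙ᵗ Q) ⊗ S ≡ t ∙ᵗ (Q ⊗ S)
  ∙ᵗ-⊗ t             []            S = refl
  ∙ᵗ-⊗ t@(c , β) ((d , δ) ∷ Q) S = trans
    (cong₂ _++_
      (trans (List.map-cong (λ (e , ε) → cong₂ _,_ (ℤ.*-assoc c d e) (·-assoc β δ ε)) S) (List.map-∘ S))
      (∙ᵗ-⊗ t Q S))
    (sym (List.map-++ _ ((d , δ) ∙ᵗ S) (Q ⊗ S)))

  ⊗-assoc : ∀ (P Q S : Poly k) → (P ⊗ Q) ⊗ S ≡ P ⊗ (Q ⊗ S)
  ⊗-assoc []      Q S = refl
  ⊗-assoc (t ∷ P) Q S = trans (⊗-distribʳ-++ (t ∙ᵗ Q) (P ⊗ Q) S) (cong₂ _++_ (∙ᵗ-⊗ t Q S) (⊗-assoc P Q S))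

  ⊗-identityˡ : ∀ (P : Poly k) → monoPoly 1ᴹ ⊗ P ≡ P
  ⊗-identityˡ P = trans (List.++-identityʳ _) (trans
    (List.map-cong (λ (c , α) → cong₂ _,_ (ℤ.*-identityˡ c) (·-identityˡ α)) P) (List.map-id P))

  ⊝-inverseʳ : ∀ (P : Poly k) → (P ++ ⊝ P) ≈ᴾ []
  ⊝-inverseʳ P α = trans (coeff-++ P (⊝ P) α) (trans (cong (ℤ._+_ (coeff P α)) (coeff-⊝ P α)) (ℤ.+-inverseʳ (coeff P α)))

  ⊝-cong : ∀ {P Q : Poly k} → P ≈ᴾ Q → ⊝ P ≈ᴾ ⊝ Q
  ⊝-cong {P} {Q} P≈Q α = trans (coeff-⊝ P α) (trans (cong ℤ.-_ (P≈Q α)) (sym (coeff-⊝ Q α)))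

polyCommutativeRing : ℕ → CommutativeRing 0ℓ 0ℓ
polyCommutativeRing k = record
  { RawRing (polyRing k)
  ; isCommutativeRing = record
    { isRing = record
      { +-isAbelianGroup = record
        { isGroup = record
          { isMonoid = record
            { isSemigroup = record
              { isMagma = record
                { isEquivalence = record
                  { refl  = λ _ → refl
                  ; sym   = λ p α → sym (p α)
                  ; trans = λ p q α → trans (p α) (q α)
                  }
                ; ∙-cong = λ {P} {P′} {Q} {Q′} → ++-cong {P = P} {P′} {Q} {Q′}
                }
              ; assoc = λ P Q S → ≈ᴾ-reflexive (List.++-assoc P Q S)
              }
            ; identity = (λ P α → refl) , (λ P → ≈ᴾ-reflexive (List.++-identityʳ P))
            }
          ; inverse = (λ P α → trans (++-comm (⊝ P) P α) (⊝-inverseʳ P α)) , ⊝-inverseʳ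
          ; ⁻¹-cong = λ {P} {Q} → ⊝-cong {P = P} {Q}
          }
        ; comm = ++-comm
        }
      ; *-cong = λ {P} {P′} {Q} {Q′} → ⊗-cong {P = P} {P′} {Q} {Q′}
      ; *-assoc = λ P Q S → ≈ᴾ-reflexive (⊗-assoc P Q S)
      ; *-identity = (λ P → ≈ᴾ-reflexive (⊗-identityˡ P))
                   , (λ P α → trans (⊗-comm P (monoPoly 1ᴹ) α) (≈ᴾ-reflexive (⊗-identityˡ P) α))
      ; distrib = (λ P Q S α → begin
            coeff (P ⊗ (Q ++ S)) α              ≡⟨ ⊗-comm P (Q ++ S) α ⟩
            coeff ((Q ++ S) ⊗ P) α              ≡⟨ ≈ᴾ-reflexive (⊗-distribʳ-++ Q S P) α ⟩
            coeff (Q ⊗ P ++ S ⊗ P) α            ≡⟨ ++-cong {P = Q ⊗ P} {P ⊗ Q} {S ⊗ P} {P ⊗ S} (⊗-comm Q P) (⊗-comm S P) α ⟩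
            coeff (P ⊗ Q ++ P ⊗ S) α            ∎)
          , (λ P Q S → ≈ᴾ-reflexive (⊗-distribʳ-++ Q S P))
      }
    ; *-comm = ⊗-comm
    }
  }
  where
  open ≡-Reasoning

-- Coefficients of the resultant

∈-splits⁺ : ∀ x {y n} → x ℕ.+ y ≡ n → (x , y) ∈ splits n
∈-splits⁺ zero    {zero}  refl = here refl
∈-splits⁺ zero    {suc y} refl = here refl
∈-splits⁺ (suc x) {y}     refl = there (∈-map⁺ (map₁ suc) (∈-splits⁺ x refl))

∈-splits⁻ : ∀ n {t} → t ∈ splits n → proj₁ t ℕ.+ proj₂ t ≡ n
∈-splits⁻ zero    (here refl) = refl
∈-splits⁻ (suc n) (here refl) = refl
∈-splits⁻ (suc n) (there t∈) with ∈-map⁻ (map₁ suc) t∈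
... | s , s∈ , refl = cong suc (∈-splits⁻ n s∈)

2*suc : ∀ a b → 2 ℕ.* suc a ℕ.+ b ≡ 2 ℕ.+ (2 ℕ.* a ℕ.+ b)
2*suc = solve-∀

∈-splits₂⁺ : ∀ a {b k} → 2 ℕ.* a ℕ.+ b ≡ k → (a , b) ∈ splits₂ k
∈-splits₂⁺ zero    {zero}        refl = here refl
∈-splits₂⁺ zero    {suc zero}    refl = here refl
∈-splits₂⁺ zero    {suc (suc b)} refl = here refl
∈-splits₂⁺ (suc a) {b} {zero}        ()
∈-splits₂⁺ (suc a) {b} {suc zero}    eq with () ← trans (sym (2*suc a b)) eq
∈-splits₂⁺ (suc a) {b} {suc (suc k)} eq = there (∈-map⁺ (map₁ suc) (∈-splits₂⁺ a (ℕ.suc-injective (ℕ.suc-injective (trans (sym (2*suc a b)) eq)))))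

∈-splits₂⁻ : ∀ k {t} → t ∈ splits₂ k → 2 ℕ.* proj₁ t ℕ.+ proj₂ t ≡ k
∈-splits₂⁻ zero          (here refl) = refl
∈-splits₂⁻ (suc zero)    (here refl) = refl
∈-splits₂⁻ (suc (suc k)) (here refl) = refl
∈-splits₂⁻ (suc (suc k)) (there t∈) with ∈-map⁻ (map₁ suc) t∈
... | (a , b) , s∈ , refl = trans (2*suc a b) (cong (2 ℕ.+_) (∈-splits₂⁻ k s∈))

unique-0∷map-suc : ∀ {y} {ts : List (ℕ Product.× ℕ)} → Unique ts → Unique ((0 , y) ∷ List.map (map₁ suc) ts)
unique-0∷map-suc {y} {ts} !ts = All.tabulate (λ s∈ eq → fresh s∈ (sym eq)) ∷ Unique.map⁺ injective !ts
  where
  injective : ∀ {s t : ℕ Product.× ℕ} → map₁ suc s ≡ map₁ suc t → s ≡ t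
  injective refl = refl
  fresh : ∀ {s} → s ∈ List.map (map₁ suc) ts → s ≢ (0 , y)
  fresh s∈ refl with ∈-map⁻ (map₁ suc) s∈
  ... | _ , _ , ()

unique-splits : ∀ n → Unique (splits n)
unique-splits zero    = [] ∷ []
unique-splits (suc n) = unique-0∷map-suc (unique-splits n)

unique-splits₂ : ∀ k → Unique (splits₂ k)
unique-splits₂ zero          = [] ∷ []
unique-splits₂ (suc zero)    = [] ∷ []
unique-splits₂ (suc (suc k)) = unique-0∷map-suc (unique-splits₂ k)

module _ {k : ℕ} where

  open ResultantExpansion (polyCommutativeRing k) using (Σᴸ)
  open import Algebra.Definitions.RawSemiring (RawRing.rawSemiring (polyRing k)) using (_^_; _×_)

  module _ {a} {A : Set a} (h : A → Poly k) (α : Monomial k) where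

    coeff-Σᴸ-zero : ∀ xs → (∀ {x} → x ∈ xs → coeff (h x) α ≡ 0ℤ) → coeff (Σᴸ xs h) α ≡ 0ℤ
    coeff-Σᴸ-zero []       h≡0 = refl
    coeff-Σᴸ-zero (x ∷ xs) h≡0 = trans (coeff-++ (h x) (Σᴸ xs h) α)
      (cong₂ ℤ._+_ (h≡0 (here refl)) (coeff-Σᴸ-zero xs (h≡0 ∘ there)))

    coeff-Σᴸ-single : ∀ {xs x₀} → Unique xs → x₀ ∈ xs → (∀ {x} → x ∈ xs → x ≢ x₀ → coeff (h x) α ≡ 0ℤ) →
                      coeff (Σᴸ xs h) α ≡ coeff (h x₀) α
    coeff-Σᴸ-single {x ∷ xs} (x∉ ∷ _) (here refl) h≡0 = trans (coeff-++ (h x) (Σᴸ xs h) α) (trans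
      (cong (ℤ._+_ (coeff (h x) α)) (coeff-Σᴸ-zero xs λ y∈ → h≡0 (there y∈) (λ { refl → All.lookup x∉ y∈ refl })))
      (ℤ.+-identityʳ _))
    coeff-Σᴸ-single {x ∷ xs} (x∉ ∷ !xs) (there x₀∈) h≡0 = trans (coeff-++ (h x) (Σᴸ xs h) α) (trans
      (cong (ℤ._+ coeff (Σᴸ xs h) α) (h≡0 (here refl) (All.lookup x∉ x₀∈)))
      (trans (ℤ.+-identityˡ _) (coeff-Σᴸ-single !xs x₀∈ (h≡0 ∘ there))))

    coeff-Σᴸ-nonzero : ∀ xs → coeff (Σᴸ xs h) α ≢ 0ℤ → ∃[ x ] x ∈ xs Product.× coeff (h x) α ≢ 0ℤ
    coeff-Σᴸ-nonzero []       ≢0 = contradiction refl ≢0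
    coeff-Σᴸ-nonzero (x ∷ xs) ≢0 with coeff (h x) α ℤ.≟ 0ℤ
    ... | no h≢0 = x , here refl , h≢0
    ... | yes h≡0 with coeff-Σᴸ-nonzero xs
      (λ Σ≡0 → ≢0 (trans (coeff-++ (h x) (Σᴸ xs h) α) (cong₂ ℤ._+_ h≡0 Σ≡0)))
    ...   | y , y∈ , h≢0 = y , there y∈ , h≢0

  -- The sign of the scalar is forgotten, and the scalar may be 0. Thus an indeterminate replaced by
  -- 0 still has a monomial, and all terms can be treated alike.
  record ScaledMonomial (P : Poly k) (γ : Monomial k) (e : ℕ) : Set where
    constructor scaled
    field
      scalar   : ℤ
      ∣scalar∣ : ∣ scalar ∣ ≡ e
      isTerm   : P ≈ᴾ (scalar , γ) ∷ []

  coeff-self : ∀ c (γ : Monomial k) → coeff ((c , γ) ∷ []) γ ≡ c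
  coeff-self c γ with Vec.≡-dec ℕ._≟_ γ γ
  ... | yes _  = ℤ.+-identityʳ c
  ... | no γ≢γ = contradiction refl γ≢γ

  coeff-other : ∀ c {γ α : Monomial k} → γ ≢ α → coeff ((c , γ) ∷ []) α ≡ 0ℤ
  coeff-other c {γ} {α} γ≢α with Vec.≡-dec ℕ._≟_ γ α
  ... | yes γ≡α = contradiction γ≡α γ≢α
  ... | no _    = refl

  ∣coeff∣-scaled : ∀ {P γ e} → ScaledMonomial P γ e → ∣ coeff P γ ∣ ≡ e
  ∣coeff∣-scaled {γ = γ} (scaled c refl P≈) = cong ∣_∣ (trans (P≈ γ) (coeff-self c γ))

  coeff-scaled-≢ : ∀ {P γ e α} → ScaledMonomial P γ e → γ ≢ α → coeff P α ≡ 0ℤ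
  coeff-scaled-≢ {α = α} (scaled c _ P≈) γ≢α = trans (P≈ α) (coeff-other c γ≢α)

  scaled-mono : ∀ γ → ScaledMonomial (monoPoly γ) γ 1
  scaled-mono γ = scaled 1ℤ refl λ _ → refl

  scaled-zero : ∀ γ → ScaledMonomial [] γ 0
  scaled-zero γ = scaled 0ℤ refl λ α → sym (zeroTerm α)
    where
    zeroTerm : ∀ α → coeff ((0ℤ , γ) ∷ []) α ≡ 0ℤ
    zeroTerm α with Vec.≡-dec ℕ._≟_ γ α
    ... | yes _ = refl
    ... | no _  = refl

  scaled-⊗ : ∀ {P Q γ δ e e′} → ScaledMonomial P γ e → ScaledMonomial Q δ e′ →
             ScaledMonomial (P ⊗ Q) (γ · δ) (e ℕ.* e′)
  scaled-⊗ {P} {Q} {γ} {δ} (scaled c refl P≈) (scaled d refl Q≈) =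
    scaled (c ℤ.* d) (ℤ.abs-* c d) (⊗-cong {P = P} {(c , γ) ∷ []} {Q} {(d , δ) ∷ []} P≈ Q≈)

  ^ᴹ-zero : ∀ {l} (γ : Monomial l) → γ ^ᴹ 0 ≡ replicate l 0
  ^ᴹ-zero []      = refl
  ^ᴹ-zero (c ∷ γ) = cong (0 ∷_) (^ᴹ-zero γ)

  ^ᴹ-suc : ∀ {l} (γ : Monomial l) m → γ ^ᴹ suc m ≡ γ · γ ^ᴹ m
  ^ᴹ-suc []      m = refl
  ^ᴹ-suc (c ∷ γ) m = cong (c ℕ.+ m ℕ.* c ∷_) (^ᴹ-suc γ m)

  scaled-^ : ∀ {P γ} m → ScaledMonomial P γ 1 → ScaledMonomial (P ^ m) (γ ^ᴹ m) 1
  scaled-^ {γ = γ} zero    _ = subst (λ δ → ScaledMonomial (monoPoly (1ᴹ {k})) δ 1) (sym (^ᴹ-zero γ)) (scaled-mono 1ᴹ)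
  scaled-^ {P} {γ} (suc m) s = subst (λ δ → ScaledMonomial (P ⊗ P ^ m) δ 1) (sym (^ᴹ-suc γ m)) (scaled-⊗ s (scaled-^ m s))

  scaled-× : ∀ {P γ e} m → ScaledMonomial P γ e → ScaledMonomial (m × P) γ (m ℕ.* e)
  scaled-× {P} {γ} m (scaled c refl P≈) = scaled (+ m ℤ.* c) (ℤ.abs-* (+ m) c) (multiple m)
    where
    sameMonomial : ∀ d α → coeff ((c , γ) ∷ (d , γ) ∷ []) α ≡ coeff ((c ℤ.+ d , γ) ∷ []) α
    sameMonomial d α with Vec.≡-dec ℕ._≟_ γ α
    ... | yes _ = trans (cong (ℤ._+_ c) (ℤ.+-identityʳ d)) (sym (ℤ.+-identityʳ (c ℤ.+ d)))
    ... | no _  = refl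
    multiple : ∀ m → m × P ≈ᴾ (+ m ℤ.* c , γ) ∷ []
    multiple zero    α = trans (ScaledMonomial.isTerm (scaled-zero γ) α)
      (cong (λ z → coeff ((z , γ) ∷ []) α) (sym (ℤ.*-zeroˡ c)))
    multiple (suc m) α = begin
      coeff (P ++ m × P) α                            ≡⟨ ++-cong {P = P} {(c , γ) ∷ []} {m × P} {(+ m ℤ.* c , γ) ∷ []} P≈ (multiple m) α ⟩
      coeff ((c , γ) ∷ (+ m ℤ.* c , γ) ∷ []) α        ≡⟨ sameMonomial (+ m ℤ.* c) α ⟩
      coeff ((c ℤ.+ + m ℤ.* c , γ) ∷ []) α            ≡⟨ cong (λ z → coeff ((z , γ) ∷ []) α) (ℤ.suc-* (+ m) c) ⟨
      coeff ((+ suc m ℤ.* c , γ) ∷ []) α              ∎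
      where open ≡-Reasoning

-- Monomials and their exponents

-- An index i ≥ k yields the zero vector. This default is harmless: `entry` is 0 there, and the zero
-- polynomial is a multiple of any monomial.
unit : ∀ k → ℕ → Monomial k
unit zero    _       = []
unit (suc k) zero    = 1 ∷ replicate k 0
unit (suc k) (suc i) = 0 ∷ unit k i

varᴹ≡unit : ∀ {k} (i : Fin k) → varᴹ i ≡ unit k (toℕ i)
varᴹ≡unit zero    = refl
varᴹ≡unit (suc i) = cong (0 ∷_) (varᴹ≡unit i)

δ : ℕ → ℕ → ℕ
δ zero    zero    = 1
δ zero    (suc j) = 0
δ (suc i) zero    = 0
δ (suc i) (suc j) = δ i j

lookup-unit : ∀ {k} i (x : Fin k) → lookup (unit k i) x ≡ δ i (toℕ x)
lookup-unit zero    zero    = refl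
lookup-unit zero    (suc x) = Vec.lookup-replicate x 0
lookup-unit (suc i) zero    = refl
lookup-unit (suc i) (suc x) = lookup-unit i x

δ-refl : ∀ i → δ i i ≡ 1
δ-refl zero    = refl
δ-refl (suc i) = δ-refl i

δ-nonzero : ∀ i j → δ i j ≢ 0 → i ≡ j
δ-nonzero zero    zero    _  = refl
δ-nonzero zero    (suc j) ≢0 = contradiction refl ≢0
δ-nonzero (suc i) zero    ≢0 = contradiction refl ≢0
δ-nonzero (suc i) (suc j) ≢0 = cong suc (δ-nonzero i j ≢0)

-- Both sides count the occurrences of x in a pair. Hence i lies in the second pair and i′ in the
-- first; if each met the larger index of the other pair, the inequalities would close a cycle and
-- make all four equal. After i is identified, cancellation leaves j.
δ+δ-injective : ∀ {n i j i′ j′} → i ≤ j → j ≤ n → i′ ≤ j′ → j′ ≤ n →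
                (∀ {x} → x ≤ n → δ i x ℕ.+ δ j x ≡ δ i′ x ℕ.+ δ j′ x) → i ≡ i′ Product.× j ≡ j′
δ+δ-injective {n} {i} {j} {i′} {j′} i≤j j≤n i′≤j′ j′≤n eq = i≡i′ , sym (δ-nonzero j′ j δj′j≢0)
  where
  one-of : ∀ {a b c d} → δ a c ℕ.+ δ b c ≡ δ c c ℕ.+ δ d c → c ≡ a ⊎ c ≡ b
  one-of {a} {b} {c} {d} e with δ a c in eqₐ
  ... | suc _ = inj₁ (sym (δ-nonzero a c λ z → ℕ.1+n≢0 (trans (sym eqₐ) z)))
  ... | zero  = inj₂ (sym (δ-nonzero b c λ z → ℕ.1+n≢0 (trans (cong (ℕ._+ δ d c) (sym (δ-refl c))) (trans (sym e) z))))
  i≡i′ : i ≡ i′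
  i≡i′ with one-of {i′} {j′} {i} {j} (sym (eq (ℕ.≤-trans i≤j j≤n))) | one-of {i} {j} {i′} {j′} (eq (ℕ.≤-trans i′≤j′ j′≤n))
  ... | inj₁ p    | _      = p
  ... | inj₂ _    | inj₁ q = sym q
  ... | inj₂ refl | inj₂ refl = ℕ.≤-antisym i≤j i′≤j′
  δj′j≢0 : δ j′ j ≢ 0
  δj′j≢0 δ≡0 = ℕ.1+n≢0 (trans (sym (δ-refl j)) (trans (ℕ.+-cancelˡ-≡ (δ i j) (δ j j) (δ j′ j)
    (trans (eq j≤n) (cong (λ l → δ l j ℕ.+ δ j′ j) (sym i≡i′)))) δ≡0))

toBit : Bool → ℕ
toBit b = if b then 1 else 0

entryBit : ∀ {k} → (Fin k → Bool) → ℕ → ℕ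
entryBit {zero}  χ _       = 0
entryBit {suc k} χ zero    = toBit (χ zero)
entryBit {suc k} χ (suc i) = entryBit (χ ∘ suc) i

toBit≤1 : ∀ b → toBit b ≤ 1
toBit≤1 false = z≤n
toBit≤1 true  = ℕ.≤-refl

entryBit≤1 : ∀ {k} (χ : Fin k → Bool) i → entryBit χ i ≤ 1
entryBit≤1 {zero}  χ _       = z≤n
entryBit≤1 {suc k} χ zero    = toBit≤1 (χ zero)
entryBit≤1 {suc k} χ (suc i) = entryBit≤1 (χ ∘ suc) i

entryBit-toℕ : ∀ {k} (χ : Fin k → Bool) i → entryBit χ (toℕ i) ≡ toBit (χ i)
entryBit-toℕ χ zero    = refl
entryBit-toℕ χ (suc i) = entryBit-toℕ (χ ∘ suc) i

module _ {l : ℕ} where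

  open Resultant (polyRing l) using (entry)

  entry-scaled : ∀ {k} {h : Vector (Poly l) k} {χ : Fin k → Bool} (μ : ℕ → Monomial l) →
                 (∀ j → ScaledMonomial (h j) (μ (toℕ j)) (toBit (χ j))) →
                 ∀ i → ScaledMonomial (entry h i) (μ i) (entryBit χ i)
  entry-scaled {zero}  μ h≈ i       = scaled-zero (μ i)
  entry-scaled {suc k} μ h≈ zero    = h≈ zero
  entry-scaled {suc k} μ h≈ (suc i) = entry-scaled (μ ∘ suc) (h≈ ∘ suc) i

lookup-· : ∀ {l} (α β : Monomial l) x → lookup (α · β) x ≡ lookup α x ℕ.+ lookup β x
lookup-· α β x = Vec.lookup-zipWith ℕ._+_ x α β

lookup-^ᴹ : ∀ {l} (α : Monomial l) e x → lookup (α ^ᴹ e) x ≡ e ℕ.* lookup α x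
lookup-^ᴹ α e x = Vec.lookup-map x (e ℕ.*_) α

lookup-product : ∀ {l} (φ₀ φ₁ φ₂ γ γ′ : Monomial l) i m a b x →
  lookup (φ₀ ^ᴹ i · (γ · (γ′ · (φ₂ ^ᴹ m · ((replicate l 0 · φ₁) ^ᴹ b · (replicate l 0 · (φ₀ · φ₂)) ^ᴹ a))))) x
  ≡ i ℕ.* lookup φ₀ x ℕ.+ (lookup γ x ℕ.+ (lookup γ′ x ℕ.+ (m ℕ.* lookup φ₂ x
      ℕ.+ (b ℕ.* lookup φ₁ x ℕ.+ a ℕ.* (lookup φ₀ x ℕ.+ lookup φ₂ x)))))
lookup-product φ₀ φ₁ φ₂ γ γ′ i m a b x =
  trans (lookup-· (φ₀ ^ᴹ i) _ x) (cong₂ ℕ._+_ (lookup-^ᴹ φ₀ i x)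
  (trans (lookup-· γ _ x) (cong (lookup γ x ℕ.+_)
  (trans (lookup-· γ′ _ x) (cong (lookup γ′ x ℕ.+_)
  (trans (lookup-· (φ₂ ^ᴹ m) _ x) (cong₂ ℕ._+_ (lookup-^ᴹ φ₂ m x)
  (trans (lookup-· ((replicate _ 0 · φ₁) ^ᴹ b) _ x) (cong₂ ℕ._+_
    (trans (lookup-^ᴹ (replicate _ 0 · φ₁) b x) (cong (λ γ → b ℕ.* lookup γ x) (·-identityˡ {0} φ₁)))
    (trans (lookup-^ᴹ (replicate _ 0 · (φ₀ · φ₂)) a x) (cong (a ℕ.*_)
      (trans (cong (λ γ → lookup γ x) (·-identityˡ {0} (φ₀ · φ₂))) (lookup-· φ₀ φ₂ x)))))))))))))

lookup-top : ∀ {l} (φ₀ φ₁ φ₂ γ γ′ : Monomial l) b a x →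
  lookup (γ · γ′ · φ₀ ^ᴹ a · φ₁ ^ᴹ b · φ₂ ^ᴹ a) x
  ≡ lookup γ x ℕ.+ lookup γ′ x ℕ.+ a ℕ.* lookup φ₀ x ℕ.+ b ℕ.* lookup φ₁ x ℕ.+ a ℕ.* lookup φ₂ x
lookup-top φ₀ φ₁ φ₂ γ γ′ b a x =
  trans (lookup-· (γ · γ′ · φ₀ ^ᴹ a · φ₁ ^ᴹ b) (φ₂ ^ᴹ a) x) (cong₂ ℕ._+_
  (trans (lookup-· (γ · γ′ · φ₀ ^ᴹ a) (φ₁ ^ᴹ b) x) (cong₂ ℕ._+_
  (trans (lookup-· (γ · γ′) (φ₀ ^ᴹ a) x) (cong₂ ℕ._+_ (lookup-· γ γ′ x) (lookup-^ᴹ φ₀ a x)))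
  (lookup-^ᴹ φ₁ b x))) (lookup-^ᴹ φ₂ a x))

lookup-ext : ∀ {l} {α β : Monomial l} → (∀ x → lookup α x ≡ lookup β x) → α ≡ β
lookup-ext {α = []}    {[]}    _  = refl
lookup-ext {α = _ ∷ _} {_ ∷ _} eq = cong₂ _∷_ (eq zero) (lookup-ext (λ x → eq (suc x)))

Index : ℕ → ℕ → ℕ Product.× ℕ → ℕ Product.× ℕ → Set
Index n i (k , m) (a , b) = i ℕ.+ (k ℕ.+ m) ≡ n Product.× 2 ℕ.* a ℕ.+ b ≡ k

-- Different indices have different monomials, so nothing cancels and every coefficient is, up to
-- sign, a single weight or 0. Injectivity concerns i, k and b; the equations in `Index` then
-- recover m and a.
module NestedSum {l : ℕ} (n : ℕ)
  (t : ℕ → ℕ Product.× ℕ → ℕ Product.× ℕ → Poly l)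
  (μ : ℕ → ℕ Product.× ℕ → ℕ Product.× ℕ → Monomial l)
  (w : ℕ → ℕ Product.× ℕ → ℕ Product.× ℕ → ℕ)
  (t-scaled : ∀ i km ab → ScaledMonomial (t i km ab) (μ i km ab) (w i km ab))
  (μ-injective : ∀ i k m a b i′ k′ m′ a′ b′ → i ℕ.+ (k ℕ.+ m) ≡ n → i′ ℕ.+ (k′ ℕ.+ m′) ≡ n →
                 μ i (k , m) (a , b) ≡ μ i′ (k′ , m′) (a′ , b′) → i ≡ i′ Product.× k ≡ k′ Product.× b ≡ b′)
  where

  open ResultantExpansion (polyCommutativeRing l) using (Σᴸ)

  columnSum : ℕ → ℕ Product.× ℕ → Poly l
  columnSum i km = Σᴸ (splits₂ (proj₁ km)) (t i km)

  rowSum : ℕ Product.× ℕ → Poly l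
  rowSum s = Σᴸ (splits (proj₂ s)) (columnSum (proj₁ s))

  ∣coeff∣-rowSum : ∀ {i km ab} → Index n i km ab → ∣ coeff (Σᴸ (splits n) rowSum) (μ i km ab) ∣ ≡ w i km ab
  ∣coeff∣-rowSum {i} {k , m} {a , b} (ikm , ab≡k) = trans
    (cong ∣_∣ (begin
      coeff (Σᴸ (splits n) rowSum) α
        ≡⟨ coeff-Σᴸ-single rowSum α (unique-splits n) (∈-splits⁺ i ikm) other-i ⟩
      coeff (rowSum (i , k ℕ.+ m)) α
        ≡⟨ coeff-Σᴸ-single (columnSum i) α (unique-splits (k ℕ.+ m)) (∈-splits⁺ k refl) other-k ⟩
      coeff (columnSum i (k , m)) α
        ≡⟨ coeff-Σᴸ-single (t i (k , m)) α (unique-splits₂ k) (∈-splits₂⁺ a ab≡k) other-ab ⟩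
      coeff (t i (k , m) (a , b)) α ∎))
    (∣coeff∣-scaled (t-scaled i (k , m) (a , b)))
    where
    open ≡-Reasoning
    α : Monomial l
    α = μ i (k , m) (a , b)
    other-i : ∀ {s} → s ∈ splits n → s ≢ (i , k ℕ.+ m) → coeff (rowSum s) α ≡ 0ℤ
    other-i {i′ , n′} s∈ s≢ = coeff-Σᴸ-zero (columnSum i′) α (splits n′) λ {(k′ , m′)} km′∈ →
      coeff-Σᴸ-zero (t i′ (k′ , m′)) α (splits₂ k′) λ {(a′ , b′)} _ →
        coeff-scaled-≢ (t-scaled i′ (k′ , m′) (a′ , b′)) λ eq →
        let i+n′≡n = ∈-splits⁻ n s∈
            i′≡i = proj₁ (μ-injective i′ k′ m′ a′ b′ i k m a b (trans (cong (i′ ℕ.+_) (∈-splits⁻ n′ km′∈)) i+n′≡n) ikm eq)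
        in s≢ (cong₂ _,_ i′≡i (ℕ.+-cancelˡ-≡ i n′ (k ℕ.+ m) (trans (cong (ℕ._+ n′) (sym i′≡i)) (trans i+n′≡n (sym ikm)))))
    other-k : ∀ {s} → s ∈ splits (k ℕ.+ m) → s ≢ (k , m) → coeff (columnSum i s) α ≡ 0ℤ
    other-k {k′ , m′} s∈ s≢ = coeff-Σᴸ-zero (t i (k′ , m′)) α (splits₂ k′) λ {(a′ , b′)} _ →
      coeff-scaled-≢ (t-scaled i (k′ , m′) (a′ , b′)) λ eq →
      let km′≡ = ∈-splits⁻ (k ℕ.+ m) s∈
          k′≡k = proj₁ (proj₂ (μ-injective i k′ m′ a′ b′ i k m a b (trans (cong (i ℕ.+_) km′≡) ikm) ikm eq))
      in s≢ (cong₂ _,_ k′≡k (ℕ.+-cancelˡ-≡ k m′ m (trans (cong (ℕ._+ m′) (sym k′≡k)) km′≡)))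
    other-ab : ∀ {s} → s ∈ splits₂ k → s ≢ (a , b) → coeff (t i (k , m) s) α ≡ 0ℤ
    other-ab {a′ , b′} s∈ s≢ = coeff-scaled-≢ (t-scaled i (k , m) (a′ , b′)) λ eq →
      let b′≡b = proj₂ (proj₂ (μ-injective i k m a′ b′ i k m a b ikm ikm eq))
          2a′+b′≡ = trans (∈-splits₂⁻ k s∈) (sym ab≡k)
      in s≢ (cong₂ _,_ (ℕ.*-cancelˡ-≡ a′ a 2 (ℕ.+-cancelʳ-≡ b (2 ℕ.* a′) (2 ℕ.* a) (trans (cong (2 ℕ.* a′ ℕ.+_) (sym b′≡b)) 2a′+b′≡))) b′≡b)

  coeff-rowSum-≢0 : ∀ {α} → coeff (Σᴸ (splits n) rowSum) α ≢ 0ℤ →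
                    ∃[ i ] ∃[ km ] ∃[ ab ] Index n i km ab Product.× α ≡ μ i km ab
  coeff-rowSum-≢0 {α} ≢0 with coeff-Σᴸ-nonzero rowSum α (splits n) ≢0
  ... | (i , n′) , i∈ , ≢0₁ with coeff-Σᴸ-nonzero (columnSum i) α (splits n′) ≢0₁
  ... | (k , m) , k∈ , ≢0₂ with coeff-Σᴸ-nonzero (t i (k , m)) α (splits₂ k) ≢0₂
  ... | (a , b) , a∈ , ≢0₃ = i , (k , m) , (a , b) ,
    (trans (cong (i ℕ.+_) (∈-splits⁻ n′ k∈)) (∈-splits⁻ n i∈) , ∈-splits₂⁻ k a∈) , α≡
    where
    α≡ : α ≡ μ i (k , m) (a , b)
    α≡ with Vec.≡-dec ℕ._≟_ (μ i (k , m) (a , b)) α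
    ... | yes eq = sym eq
    ... | no ≢α  = contradiction (coeff-scaled-≢ (t-scaled i (k , m) (a , b)) ≢α) ≢0₃

  ∣coeff∣-rowSum-≤ : ∀ {M} → (∀ {i km ab} → Index n i km ab → w i km ab ≤ M) →
                     ∀ α → ∣ coeff (Σᴸ (splits n) rowSum) α ∣ ≤ M
  ∣coeff∣-rowSum-≤ w≤M α with coeff (Σᴸ (splits n) rowSum) α ℤ.≟ 0ℤ
  ... | yes ≡0 = subst (λ z → ∣ z ∣ ≤ _) (sym ≡0) z≤n
  ... | no ≢0 with coeff-rowSum-≢0 ≢0
  ...   | i , km , ab , index , refl = subst (_≤ _) (sym (∣coeff∣-rowSum index)) (w≤M index)

-- Some of the indeterminates g_j may be replaced by 0: this covers both resultants of the theorem.
module _ (n : ℕ) (χ : Fin (suc n) → Bool) where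

  open Resultant (polyRing (numVars n))
  open ResultantExpansion (polyCommutativeRing (numVars n)) using (Σᴸ; module Quadratic)
  open Quadratic (genericF n) using (term; Res-expansion)

  partialG : Vector (Poly (numVars n)) (suc n)
  partialG j = if χ j then genericG n j else []

  partialRes : Poly (numVars n)
  partialRes = Res {2} {n} (genericF n) partialG

  gᵘ : ℕ → Monomial (numVars n)
  gᵘ i = unit (numVars n) (3 ℕ.+ i)

  F : Fin 3 → Monomial (numVars n)
  F = fᴹ n

  -- This and `weight` copy the product in `term` factor by factor, with `1ᴹ` for the sign ν inside
  -- x and y, so that `term-scaled` needs no rearrangement.
  termMonomial : ℕ → ℕ Product.× ℕ → ℕ Product.× ℕ → Monomial (numVars n)
  termMonomial i (k , m) (a , b) =
    F zero ^ᴹ i · (gᵘ i · (gᵘ (i ℕ.+ k) · (F (suc (suc zero)) ^ᴹ m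
      · ((1ᴹ {numVars n} · F (suc zero)) ^ᴹ b · (1ᴹ {numVars n} · (F zero · F (suc (suc zero)))) ^ᴹ a))))

  weight : ℕ → ℕ Product.× ℕ → ℕ Product.× ℕ → ℕ
  weight i (k , m) (a , b) =
    1 ℕ.* (entryBit χ i ℕ.* (entryBit χ (i ℕ.+ k) ℕ.* (1 ℕ.* (lucas a b ℕ.* (1 ℕ.* 1)))))

  term-scaled : ∀ i km ab → ScaledMonomial (term {n} partialG i km ab) (termMonomial i km ab) (weight i km ab)
  term-scaled i (k , m) (a , b) =
    scaled-⊗ (scaled-^ i (scaled-mono (F zero)))
      (scaled-⊗ (g-scaled i) (scaled-⊗ (g-scaled (i ℕ.+ k)) (scaled-⊗ (scaled-^ m (scaled-mono (F (suc (suc zero)))))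
        (scaled-× (lucas a b) (scaled-⊗
          (scaled-^ b (scaled-⊗ ν-scaled (scaled-mono (F (suc zero)))))
          (scaled-^ a (scaled-⊗ ν-scaled (scaled-⊗ (scaled-mono (F zero)) (scaled-mono (F (suc (suc zero))))))))))))
    where
    ν-scaled : ScaledMonomial (⊝ monoPoly (1ᴹ {numVars n})) (1ᴹ {numVars n}) 1
    ν-scaled = scaled (ℤ.- 1ℤ) refl λ _ → refl
    g-scaled : ∀ i → ScaledMonomial (entry partialG i) (gᵘ i) (entryBit χ i)
    g-scaled = entry-scaled gᵘ coordinate
      where
      coordinate : ∀ j → ScaledMonomial (partialG j) (gᵘ (toℕ j)) (toBit (χ j))
      coordinate j with χ j
      ... | false = scaled-zero (gᵘ (toℕ j))
      ... | true  = subst (λ γ → ScaledMonomial (genericG n j) γ 1)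
        (cong (λ γ → 0 ∷ 0 ∷ 0 ∷ γ) (varᴹ≡unit j)) (scaled-mono (gᴹ n j))

  lookup-f₁ : ∀ i k m a b → lookup (termMonomial i (k , m) (a , b)) (suc zero) ≡ b
  lookup-f₁ i k m a b = trans
    (lookup-product (F zero) (F (suc zero)) (F (suc (suc zero))) (gᵘ i) (gᵘ (i ℕ.+ k)) i m a b (suc zero))
    (collapse i m a b)
    where
    collapse : ∀ i m a b → i ℕ.* 0 ℕ.+ (0 ℕ.+ (0 ℕ.+ (m ℕ.* 0 ℕ.+ (b ℕ.* 1 ℕ.+ a ℕ.* (0 ℕ.+ 0))))) ≡ b
    collapse = solve-∀

  lookup-g : ∀ i k m a b (x : Fin (suc n)) →
             lookup (termMonomial i (k , m) (a , b)) (3 ↑ʳ x) ≡ δ i (toℕ x) ℕ.+ δ (i ℕ.+ k) (toℕ x)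
  lookup-g i k m a b x
    with eq ← lookup-product (F zero) (F (suc zero)) (F (suc (suc zero))) (gᵘ i) (gᵘ (i ℕ.+ k)) i m a b (3 ↑ʳ x)
    rewrite Vec.lookup-replicate x 0 | lookup-unit i x | lookup-unit (i ℕ.+ k) x
    = trans eq (collapse i m a b (δ i (toℕ x)) (δ (i ℕ.+ k) (toℕ x)))
    where
    collapse : ∀ i m a b p q → i ℕ.* 0 ℕ.+ (p ℕ.+ (q ℕ.+ (m ℕ.* 0 ℕ.+ (b ℕ.* 0 ℕ.+ a ℕ.* (0 ℕ.+ 0))))) ≡ p ℕ.+ q
    collapse = solve-∀

  topMonomial≡ : ∀ A → topMonomial n A ≡ termMonomial 0 (n , 0) (A , n ∸ 2 ℕ.* A)
  topMonomial≡ A = lookup-ext λ x → begin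
    lookup (topMonomial n A) x
      ≡⟨ lookup-top (F zero) (F (suc zero)) (F (suc (suc zero))) (gᴹ n zero) (gᴹ n (fromℕ n)) B A x ⟩
    lookup (gᵘ 0) x ℕ.+ lookup (gᴹ n (fromℕ n)) x ℕ.+ A ℕ.* f₀ x ℕ.+ B ℕ.* f₁ x ℕ.+ A ℕ.* f₂ x
      ≡⟨ cong (λ γ → lookup (gᵘ 0) x ℕ.+ lookup γ x ℕ.+ A ℕ.* f₀ x ℕ.+ B ℕ.* f₁ x ℕ.+ A ℕ.* f₂ x) gₙ≡ ⟩
    lookup (gᵘ 0) x ℕ.+ lookup (gᵘ n) x ℕ.+ A ℕ.* f₀ x ℕ.+ B ℕ.* f₁ x ℕ.+ A ℕ.* f₂ x
      ≡⟨ regroup (lookup (gᵘ 0) x) (lookup (gᵘ n) x) A B (f₀ x) (f₁ x) (f₂ x) ⟩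
    0 ℕ.* f₀ x ℕ.+ (lookup (gᵘ 0) x ℕ.+ (lookup (gᵘ n) x ℕ.+ (0 ℕ.* f₂ x ℕ.+ (B ℕ.* f₁ x ℕ.+ A ℕ.* (f₀ x ℕ.+ f₂ x)))))
      ≡⟨ lookup-product (F zero) (F (suc zero)) (F (suc (suc zero))) (gᵘ 0) (gᵘ n) 0 0 A B x ⟨
    lookup (termMonomial 0 (n , 0) (A , B)) x ∎
    where
    open ≡-Reasoning
    B : ℕ
    B = n ∸ 2 ℕ.* A
    f₀ f₁ f₂ : Fin (numVars n) → ℕ
    f₀ = lookup (F zero)
    f₁ = lookup (F (suc zero))
    f₂ = lookup (F (suc (suc zero)))
    gₙ≡ : gᴹ n (fromℕ n) ≡ gᵘ n
    gₙ≡ = trans (cong (λ γ → 0 ∷ 0 ∷ 0 ∷ γ) (varᴹ≡unit (fromℕ n))) (cong gᵘ (Fin.toℕ-fromℕ n))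
    regroup : ∀ p q A B u v w → p ℕ.+ q ℕ.+ A ℕ.* u ℕ.+ B ℕ.* v ℕ.+ A ℕ.* w
      ≡ 0 ℕ.* u ℕ.+ (p ℕ.+ (q ℕ.+ (0 ℕ.* w ℕ.+ (B ℕ.* v ℕ.+ A ℕ.* (u ℕ.+ w)))))
    regroup = solve-∀

  weight≤lucas : ∀ i k m a b → weight i (k , m) (a , b) ≤ lucas a b
  weight≤lucas i k m a b = begin
    1 ℕ.* (w₁ ℕ.* (w₂ ℕ.* (1 ℕ.* (lucas a b ℕ.* (1 ℕ.* 1)))))  ≡⟨ regroup w₁ w₂ (lucas a b) ⟩
    w₁ ℕ.* w₂ ℕ.* lucas a b                                    ≤⟨ ℕ.*-monoˡ-≤ (lucas a b) (ℕ.*-mono-≤ (entryBit≤1 χ i) (entryBit≤1 χ (i ℕ.+ k))) ⟩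
    1 ℕ.* lucas a b                                          ≡⟨ ℕ.*-identityˡ (lucas a b) ⟩
    lucas a b                                                ∎
    where
    open ℕ.≤-Reasoning
    w₁ w₂ : ℕ
    w₁ = entryBit χ i
    w₂ = entryBit χ (i ℕ.+ k)
    regroup : ∀ p q l → 1 ℕ.* (p ℕ.* (q ℕ.* (1 ℕ.* (l ℕ.* (1 ℕ.* 1))))) ≡ p ℕ.* q ℕ.* l
    regroup = solve-∀

  -- The exponents of the g-variables reveal the pair i ≤ i + k, and f₁ occurs only in x, so its
  -- exponent is b.
  termMonomial-injective : ∀ i k m a b i′ k′ m′ a′ b′ → i ℕ.+ (k ℕ.+ m) ≡ n → i′ ℕ.+ (k′ ℕ.+ m′) ≡ n →
    termMonomial i (k , m) (a , b) ≡ termMonomial i′ (k′ , m′) (a′ , b′) → i ≡ i′ Product.× k ≡ k′ Product.× b ≡ b′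
  termMonomial-injective i k m a b i′ k′ m′ a′ b′ ikm ikm′ eq =
    proj₁ gs
    , ℕ.+-cancelˡ-≡ i k k′ (trans (proj₂ gs) (cong (ℕ._+ k′) (sym (proj₁ gs))))
    , trans (sym (lookup-f₁ i k m a b)) (trans (cong (λ γ → lookup γ (suc zero)) eq) (lookup-f₁ i′ k′ m′ a′ b′))
    where
    i+k≤n : ∀ {i k m} → i ℕ.+ (k ℕ.+ m) ≡ n → i ℕ.+ k ≤ n
    i+k≤n {i} {k} {m} e = subst (i ℕ.+ k ≤_) (trans (ℕ.+-assoc i k m) e) (ℕ.m≤m+n (i ℕ.+ k) m)
    exponents : ∀ {x} → x ≤ n → δ i x ℕ.+ δ (i ℕ.+ k) x ≡ δ i′ x ℕ.+ δ (i′ ℕ.+ k′) x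
    exponents {x} x≤n = subst (λ x → δ i x ℕ.+ δ (i ℕ.+ k) x ≡ δ i′ x ℕ.+ δ (i′ ℕ.+ k′) x)
      (Fin.toℕ-fromℕ< (s≤s x≤n))
      (trans (sym (lookup-g i k m a b x′)) (trans (cong (λ γ → lookup γ (3 ↑ʳ x′)) eq) (lookup-g i′ k′ m′ a′ b′ x′)))
      where
      x′ : Fin (suc n)
      x′ = fromℕ< (s≤s x≤n)
    gs : i ≡ i′ Product.× i ℕ.+ k ≡ i′ ℕ.+ k′
    gs = δ+δ-injective (ℕ.m≤m+n i k) (i+k≤n {i} ikm) (ℕ.m≤m+n i′ k′) (i+k≤n {i′} ikm′) exponents

  open NestedSum n (term {n} partialG) termMonomial weight term-scaled termMonomial-injective

  partialRes-expansion : ∀ α → coeff partialRes α ≡ coeff (Σᴸ (splits n) rowSum) α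
  partialRes-expansion = Res-expansion {n} partialG

  coeff-bound : ∀ {M} → (∀ a b → 2 ℕ.* a ℕ.+ b ≤ n → lucas a b ≤ M) → ∀ α → ∣ coeff partialRes α ∣ ≤ M
  coeff-bound {M} lucas≤M α = subst (λ z → ∣ z ∣ ≤ M) (sym (partialRes-expansion α))
    (∣coeff∣-rowSum-≤ (λ {i} {km} {ab} → weight≤M {i} {km} {ab}) α)
    where
    weight≤M : ∀ {i km ab} → Index n i km ab → weight i km ab ≤ M
    weight≤M {i} {k , m} {a , b} (ikm , ab≡k) = ℕ.≤-trans (weight≤lucas i k m a b) (lucas≤M a b
      (ℕ.≤-trans (ℕ.≤-reflexive ab≡k) (ℕ.≤-trans (ℕ.m≤m+n k m) (ℕ.≤-trans (ℕ.m≤n+m (k ℕ.+ m) i) (ℕ.≤-reflexive ikm)))))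

  -- The monomial is that of the index i = 0, k = n, m = 0, a = A, and both of its g-variables are
  -- kept.
  coeff-top : χ zero ≡ true → χ (fromℕ n) ≡ true → ∀ {A} → 2 ℕ.* A ≤ n →
              ∣ coeff partialRes (topMonomial n A) ∣ ≡ lucas A (n ∸ 2 ℕ.* A)
  coeff-top χ₀ χₙ {A} 2A≤n = begin
    ∣ coeff partialRes (topMonomial n A) ∣           ≡⟨ cong (λ α → ∣ coeff partialRes α ∣) (topMonomial≡ A) ⟩
    ∣ coeff partialRes (termMonomial 0 (n , 0) (A , B)) ∣ ≡⟨ cong ∣_∣ (partialRes-expansion (termMonomial 0 (n , 0) (A , B))) ⟩
    ∣ coeff (Σᴸ (splits n) rowSum) (termMonomial 0 (n , 0) (A , B)) ∣
      ≡⟨ ∣coeff∣-rowSum {0} {n , 0} {A , B} (ℕ.+-identityʳ n , ℕ.m+[n∸m]≡n 2A≤n) ⟩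
    1 ℕ.* (entryBit χ 0 ℕ.* (entryBit χ n ℕ.* (1 ℕ.* (lucas A B ℕ.* (1 ℕ.* 1)))))
      ≡⟨ cong₂ (λ p q → 1 ℕ.* (p ℕ.* (q ℕ.* (1 ℕ.* (lucas A B ℕ.* (1 ℕ.* 1)))))) (cong toBit χ₀) bitₙ ⟩
    1 ℕ.* (1 ℕ.* (1 ℕ.* (1 ℕ.* (lucas A B ℕ.* (1 ℕ.* 1)))))  ≡⟨ units (lucas A B) ⟩
    lucas A B ∎
    where
    open ≡-Reasoning
    B : ℕ
    B = n ∸ 2 ℕ.* A
    bitₙ : entryBit χ n ≡ 1
    bitₙ = trans (cong (entryBit χ) (sym (Fin.toℕ-fromℕ n))) (trans (entryBit-toℕ χ (fromℕ n)) (cong toBit χₙ))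
    units : ∀ l → 1 ℕ.* (1 ℕ.* (1 ℕ.* (1 ℕ.* (l ℕ.* (1 ℕ.* 1))))) ≡ l
    units = solve-∀

-- The largest coefficient

module LucasNumbers where

  open import Data.Nat.Base using (_+_; _*_)

  binom-monoʳ : ∀ a b → binom a b ≤ binom a (suc b)
  binom-monoʳ zero    b = ℕ.≤-refl
  binom-monoʳ (suc a) b = ℕ.m≤n+m (binom (suc a) b) (binom a (suc b))

  lucas-monoʳ : ∀ a b c → lucas a b ≤ lucas a (b + c)
  lucas-monoʳ a b zero    = ℕ.≤-reflexive (cong (lucas a) (sym (ℕ.+-identityʳ b)))
  lucas-monoʳ a b (suc c) = ℕ.≤-trans (lucas-monoʳ a b c)
    (ℕ.≤-trans (step a (b + c)) (ℕ.≤-reflexive (cong (lucas a) (sym (ℕ.+-suc b c)))))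
    where
    step : ∀ a b → lucas a b ≤ lucas a (suc b)
    step zero    b = ℕ.≤-refl
    step (suc a) b = ℕ.+-mono-≤ (binom-monoʳ (suc a) b) (binom-monoʳ a b)

  lucas-positive : ∀ a b → 1 ≤ lucas a b
  lucas-positive zero    b = ℕ.≤-refl
  lucas-positive (suc a) b = ℕ.≤-trans (binom-positive (suc a) b) (ℕ.m≤m+n _ _)
    where
    binom-positive : ∀ a b → 1 ≤ binom a b
    binom-positive zero    b       = ℕ.≤-refl
    binom-positive (suc a) zero    = ℕ.≤-refl
    binom-positive (suc a) (suc b) = ℕ.≤-trans (binom-positive a (suc b)) (ℕ.m≤m+n _ _)

  binom-! : ∀ a b → binom a b * (a ! * b !) ≡ (a + b) !
  binom-! zero    b    = trans (ℕ.*-identityˡ (1 * b !)) (ℕ.*-identityˡ (b !))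
  binom-! (suc a) zero = trans (ℕ.*-identityˡ (suc a ! * 1)) (trans (ℕ.*-identityʳ (suc a !)) (cong _! (sym (ℕ.+-identityʳ (suc a)))))
  binom-! (suc a) (suc b) = begin
    (binom a (suc b) + binom (suc a) b) * (suc a * a ! * (suc b * b !))
      ≡⟨ spread (binom a (suc b)) (binom (suc a) b) (suc a) (a !) (suc b) (b !) ⟩
    suc a * (binom a (suc b) * (a ! * (suc b * b !))) + suc b * (binom (suc a) b * (suc a * a ! * b !))
      ≡⟨ cong₂ (λ s t → suc a * s + suc b * t) (binom-! a (suc b)) (binom-! (suc a) b) ⟩
    suc a * (a + suc b) ! + suc b * (suc a + b) !
      ≡⟨ cong (λ s → suc a * (a + suc b) ! + suc b * s !) (sym (ℕ.+-suc a b)) ⟩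
    suc a * (a + suc b) ! + suc b * (a + suc b) !
      ≡⟨ ℕ.*-distribʳ-+ ((a + suc b) !) (suc a) (suc b) ⟨
    (suc a + suc b) ! ∎
    where
    open ≡-Reasoning
    spread : ∀ u v x y z w → (u + v) * (x * y * (z * w)) ≡ x * (u * (y * (z * w))) + z * (v * (x * y * w))
    spread = solve-∀

  -- The division-free form of k (k-a-1)! / ((k-2a)! a!), with k = 2a + b and m = k - a - 1.
  lucas-! : ∀ a b {m} → a + b ≡ suc m → lucas a b * (a ! * b !) ≡ (2 * a + b) * m !
  lucas-! zero    (suc b) refl = trans (ℕ.*-identityˡ (1 * suc b !)) (ℕ.*-identityˡ (suc b !))
  lucas-! (suc a) b       refl = begin
    (binom (suc a) b + binom a b) * (suc a * a ! * b !)
      ≡⟨ spread (binom (suc a) b) (binom a b) (suc a) (a !) (b !) ⟩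
    binom (suc a) b * (suc a * a ! * b !) + suc a * (binom a b * (a ! * b !))
      ≡⟨ cong₂ (λ s t → s + suc a * t) (binom-! (suc a) b) (binom-! a b) ⟩
    suc (a + b) * (a + b) ! + suc a * (a + b) !
      ≡⟨ collect a b ((a + b) !) ⟩
    (2 * suc a + b) * (a + b) ! ∎
    where
    open ≡-Reasoning
    spread : ∀ u v x y z → (u + v) * (x * y * z) ≡ u * (x * y * z) + x * (v * (y * z))
    spread = solve-∀
    collect : ∀ a b z → suc (a + b) * z + suc a * z ≡ (2 * suc a + b) * z
    collect = solve-∀

  -- Both numbers belong to k = 2a + b + 2. At z = a + 1 the two factors are z (k - z) and (k - 2z +
  -- 1)(k - 2z + 2), whose difference is p_k(z); so the sign of p_k(a + 1) decides which number is
  -- larger.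
  lucas-ratio : ∀ a b → lucas (suc a) b * (suc a * suc (a + b)) ≡ lucas a (2 + b) * ((2 + b) * suc b)
  lucas-ratio a b = ℕ.*-cancelʳ-≡ _ _ (a ! * b !) {{ a ℕ.!* b !≢0 }} (begin
    lucas (suc a) b * (suc a * suc (a + b)) * (a ! * b !)
      ≡⟨ regroup₁ (lucas (suc a) b) (suc a) (suc (a + b)) (a !) (b !) ⟩
    suc (a + b) * (lucas (suc a) b * (suc a * a ! * b !))
      ≡⟨ cong (suc (a + b) *_) (lucas-! (suc a) b refl) ⟩
    suc (a + b) * ((2 * suc a + b) * (a + b) !)
      ≡⟨ regroup₂ a b (suc (a + b)) ((a + b) !) ⟩
    (2 * a + (2 + b)) * (suc (a + b) * (a + b) !)
      ≡⟨ lucas-! a (2 + b) (trans (ℕ.+-suc a (suc b)) (cong suc (ℕ.+-suc a b))) ⟨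
    lucas a (2 + b) * (a ! * ((2 + b) * (suc b * b !)))
      ≡⟨ regroup₃ (lucas a (2 + b)) (a !) (2 + b) (suc b) (b !) ⟩
    lucas a (2 + b) * ((2 + b) * suc b) * (a ! * b !) ∎)
    where
    open ≡-Reasoning
    regroup₁ : ∀ l x y z w → l * (x * y) * (z * w) ≡ y * (l * (x * z * w))
    regroup₁ = solve-∀
    regroup₂ : ∀ a b x y → x * ((2 * suc a + b) * y) ≡ (2 * a + (2 + b)) * (x * y)
    regroup₂ = solve-∀
    regroup₃ : ∀ l x y z w → l * (x * (y * (z * w))) ≡ l * (y * z) * (x * w)
    regroup₃ = solve-∀

  lucas-up : ∀ a b → suc a * suc (a + b) ≤ (2 + b) * suc b → lucas a (2 + b) ≤ lucas (suc a) b
  lucas-up a b c≤d = ℕ.*-cancelʳ-≤ _ _ (suc a * suc (a + b))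
    (ℕ.≤-trans (ℕ.*-monoʳ-≤ (lucas a (2 + b)) c≤d) (ℕ.≤-reflexive (sym (lucas-ratio a b))))

  lucas-down : ∀ a b → (2 + b) * suc b ≤ suc a * suc (a + b) → lucas (suc a) b ≤ lucas a (2 + b)
  lucas-down a b d≤c = ℕ.*-cancelʳ-≤ _ _ ((2 + b) * suc b)
    (ℕ.≤-trans (ℕ.*-monoʳ-≤ (lucas (suc a) b) d≤c) (ℕ.≤-reflexive (lucas-ratio a b)))

  -- Monotonicity of z (n - z) up to n/2, between z = u and z = u + d, for n = 2u + v + 2d.
  product-grows : ∀ u v d → u * (u + v + 2 * d) ≤ (u + d) * (u + d + v)
  product-grows u v d = ℕ.≤-trans (ℕ.m≤m+n _ (d * (v + d))) (ℕ.≤-reflexive (identity u v d))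
    where
    identity : ∀ u v d → u * (u + v + 2 * d) + d * (v + d) ≡ (u + d) * (u + d + v)
    identity = solve-∀

  -- One inequality at the end point governs the whole climb: for smaller z, the product z (n - z)
  -- is smaller and (n - 2z + 1)(n - 2z + 2) is larger.
  lucas-increasing : ∀ d a B → (a + d) * (a + d + B) ≤ (2 + B) * suc B → lucas a (B + 2 * d) ≤ lucas (a + d) B
  lucas-increasing zero    a B c = ℕ.≤-reflexive (cong₂ lucas (sym (ℕ.+-identityʳ a)) (ℕ.+-identityʳ B))
  lucas-increasing (suc d) a B c = begin
    lucas a (B + 2 * suc d)       ≡⟨ cong (lucas a) (shift B d) ⟩
    lucas a (2 + (B + 2 * d))     ≤⟨ lucas-up a (B + 2 * d) small ⟩
    lucas (suc a) (B + 2 * d)     ≤⟨ lucas-increasing d (suc a) B (ℕ.≤-trans (ℕ.≤-reflexive (cong (λ s → s * (s + B)) (sym (ℕ.+-suc a d)))) c) ⟩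
    lucas (suc a + d) B           ≡⟨ cong (λ s → lucas s B) (ℕ.+-suc a d) ⟨
    lucas (a + suc d) B           ∎
    where
    open ℕ.≤-Reasoning
    shift : ∀ B d → B + 2 * suc d ≡ 2 + (B + 2 * d)
    shift = solve-∀
    small : suc a * suc (a + (B + 2 * d)) ≤ (2 + (B + 2 * d)) * suc (B + 2 * d)
    small = begin
      suc a * suc (a + (B + 2 * d))              ≡⟨ cong (suc a *_) (cong suc (sym (ℕ.+-assoc a B (2 * d)))) ⟩
      suc a * (suc a + B + 2 * d)                ≤⟨ product-grows (suc a) B d ⟩
      (suc a + d) * (suc a + d + B)              ≡⟨ cong (λ s → s * (s + B)) (ℕ.+-suc a d) ⟨
      (a + suc d) * (a + suc d + B)              ≤⟨ c ⟩
      (2 + B) * suc B                            ≤⟨ ℕ.*-mono-≤ (ℕ.+-monoʳ-≤ 2 (ℕ.m≤m+n B (2 * d))) (s≤s (ℕ.m≤m+n B (2 * d))) ⟩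
      (2 + (B + 2 * d)) * suc (B + 2 * d)        ∎

  -- Here the inequality at A + 1 governs all later steps, by the same monotonicity. It is required
  -- only if A + 1 is still in range, that is, if b + 2d is at least 2.
  lucas-decreasing : ∀ d A b → (∀ {B} → b + 2 * d ≡ 2 + B → (2 + B) * suc B ≤ suc A * suc (A + B)) →
                     lucas (A + d) b ≤ lucas A (b + 2 * d)
  lucas-decreasing zero    A b c = ℕ.≤-reflexive (cong₂ lucas (ℕ.+-identityʳ A) (sym (ℕ.+-identityʳ b)))
  lucas-decreasing (suc d) A b c = begin
    lucas (A + suc d) b           ≡⟨ cong (λ s → lucas s b) (ℕ.+-suc A d) ⟩
    lucas (suc (A + d)) b         ≤⟨ lucas-down (A + d) b large ⟩
    lucas (A + d) (2 + b)         ≤⟨ lucas-decreasing d A (2 + b) (λ eq → c (trans (shift b d) eq)) ⟩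
    lucas A (2 + b + 2 * d)       ≡⟨ cong (lucas A) (shift b d) ⟨
    lucas A (b + 2 * suc d)       ∎
    where
    open ℕ.≤-Reasoning
    shift : ∀ b d → b + 2 * suc d ≡ 2 + b + 2 * d
    shift = solve-∀
    large : (2 + b) * suc b ≤ suc (A + d) * suc (A + d + b)
    large = begin
      (2 + b) * suc b                          ≤⟨ ℕ.*-mono-≤ (ℕ.+-monoʳ-≤ 2 (ℕ.m≤m+n b (2 * d))) (s≤s (ℕ.m≤m+n b (2 * d))) ⟩
      (2 + (b + 2 * d)) * suc (b + 2 * d)      ≤⟨ c (shift b d) ⟩
      suc A * suc (A + (b + 2 * d))            ≡⟨ cong (λ s → suc A * suc s) (sym (ℕ.+-assoc A b (2 * d))) ⟩
      suc A * (suc A + b + 2 * d)              ≤⟨ product-grows (suc A) b d ⟩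
      suc (A + d) * suc (A + d + b)            ∎

  -- With B = n - 2A, the two hypotheses say p n A ≥ 0 and, when A + 1 ≤ n / 2, p n (A + 1) ≤ 0.
  lucas-maximal : ∀ {n A B} → 2 * A + B ≡ n → A * (A + B) ≤ (2 + B) * suc B →
                  (∀ {B′} → B ≡ 2 + B′ → (2 + B′) * suc B′ ≤ suc A * suc (A + B′)) →
                  ∀ a b → 2 * a + b ≤ n → lucas a b ≤ lucas A B
  lucas-maximal {n} {A} {B} refl pA≥0 pA+1≤0 a b 2a+b≤n with ℕ.m≤n⇒∃[o]m+o≡n 2a+b≤n | ℕ.≤-total a A
  ... | c , 2a+b+c≡n | inj₁ a≤A with ℕ.m≤n⇒∃[o]m+o≡n a≤A
  ...   | d , refl = begin
    -- The missing weight c goes into b; then the exchange of 2 units of b for 1 unit of a leads up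
    -- to A.
    lucas a b               ≤⟨ lucas-monoʳ a b c ⟩
    lucas a (b + c)         ≡⟨ cong (lucas a) (ℕ.+-cancelˡ-≡ (2 * a) (b + c) (B + 2 * d) (trans (sym (ℕ.+-assoc (2 * a) b c)) (trans 2a+b+c≡n (regroup a B d)))) ⟩
    lucas a (B + 2 * d)     ≤⟨ lucas-increasing d a B pA≥0 ⟩
    lucas (a + d) B         ∎
    where
    open ℕ.≤-Reasoning
    regroup : ∀ a B d → 2 * (a + d) + B ≡ 2 * a + (B + 2 * d)
    regroup = solve-∀
  lucas-maximal {n} {A} {B} refl pA≥0 pA+1≤0 a b 2a+b≤n | c , 2a+b+c≡n | inj₂ A≤a with ℕ.m≤n⇒∃[o]m+o≡n A≤a
  ...   | d , refl = begin
    lucas (A + d) b               ≤⟨ lucas-monoʳ (A + d) b c ⟩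
    lucas (A + d) (b + c)         ≤⟨ lucas-decreasing d A (b + c) (λ eq → pA+1≤0 (trans (sym b+c+2d≡B) eq)) ⟩
    lucas A (b + c + 2 * d)       ≡⟨ cong (lucas A) b+c+2d≡B ⟩
    lucas A B                     ∎
    where
    open ℕ.≤-Reasoning
    regroup : ∀ A b c d → 2 * A + (b + c + 2 * d) ≡ 2 * (A + d) + b + c
    regroup = solve-∀
    b+c+2d≡B : b + c + 2 * d ≡ B
    b+c+2d≡B = ℕ.+-cancelˡ-≡ (2 * A) (b + c + 2 * d) B (trans (regroup A b c d) 2a+b+c≡n)

-- From the real root to integer inequalities

module RationalApproximation where

  open import Data.Rational.Base as ℚ using (ℚ; 0ℚ; 1ℚ; ½; _+_; _*_; _-_; -_; _/_; 1/_; toℚᵘ)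
  open import Data.Rational.Solver using (module +-*-Solver)

  ι : ℤ → ℚ
  ι z = z / 1

  toℚᵘ-ι : ∀ z → toℚᵘ (ι z) ≃ mkℚᵘ z 0
  toℚᵘ-ι z = ℚ.toℚᵘ-fromℚᵘ (mkℚᵘ z 0)

  ι-+ : ∀ y z → ι (y ℤ.+ z) ≡ ι y + ι z
  ι-+ y z = ℚ.toℚᵘ-injective (begin
    toℚᵘ (ι (y ℤ.+ z))            ≈⟨ toℚᵘ-ι (y ℤ.+ z) ⟩
    mkℚᵘ (y ℤ.+ z) 0              ≈⟨ *≡* (cong (ℤ._* + 1) (sym (cong₂ ℤ._+_ (ℤ.*-identityʳ y) (ℤ.*-identityʳ z)))) ⟩
    mkℚᵘ y 0 ℚᵘ.+ mkℚᵘ z 0        ≈⟨ ℚᵘ.+-cong (toℚᵘ-ι y) (toℚᵘ-ι z) ⟨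
    toℚᵘ (ι y) ℚᵘ.+ toℚᵘ (ι z)    ≈⟨ ℚ.toℚᵘ-homo-+ (ι y) (ι z) ⟨
    toℚᵘ (ι y + ι z)              ∎)
    where open import Relation.Binary.Reasoning.Setoid ℚᵘ.≃-setoid

  ι-* : ∀ y z → ι (y ℤ.* z) ≡ ι y * ι z
  ι-* y z = ℚ.toℚᵘ-injective (begin
    toℚᵘ (ι (y ℤ.* z))            ≈⟨ toℚᵘ-ι (y ℤ.* z) ⟩
    mkℚᵘ (y ℤ.* z) 0              ≈⟨ *≡* refl ⟩
    mkℚᵘ y 0 ℚᵘ.* mkℚᵘ z 0        ≈⟨ ℚᵘ.*-cong (toℚᵘ-ι y) (toℚᵘ-ι z) ⟨
    toℚᵘ (ι y) ℚᵘ.* toℚᵘ (ι z)    ≈⟨ ℚ.toℚᵘ-homo-* (ι y) (ι z) ⟨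
    toℚᵘ (ι y * ι z)              ∎)
    where open import Relation.Binary.Reasoning.Setoid ℚᵘ.≃-setoid

  ι-cancel-< : ∀ {y z} → ι y ℚ.< ι z → y ℤ.< z
  ι-cancel-< {y} {z} ιy<ιz = subst₂ ℤ._<_ (ℤ.*-identityʳ y) (ℤ.*-identityʳ z) (ℚᵘ.drop-*<*
    (ℚᵘ.<-respˡ-≃ (toℚᵘ-ι y) (ℚᵘ.<-respʳ-≃ (toℚᵘ-ι z) (ℚ.toℚᵘ-mono-< ιy<ιz))))

  ιℕ : ℕ → ℚ
  ιℕ k = ι (+ k)

  ιℕ-+ : ∀ j k → ιℕ (j ℕ.+ k) ≡ ιℕ j + ιℕ k
  ιℕ-+ j k = ι-+ (+ j) (+ k)

  ιℕ-* : ∀ j k → ιℕ (j ℕ.* k) ≡ ιℕ j * ιℕ k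
  ιℕ-* j k = trans (cong ι (ℤ.pos-* j k)) (ι-* (+ j) (+ k))

  ιℕ-cancel-< : ∀ {j k} → ιℕ j ℚ.< ιℕ k → j ℕ.< k
  ιℕ-cancel-< ιj<ιk = ℤ.drop‿+<+ (ι-cancel-< ιj<ιk)

  0≤ιℕ : ∀ k → 0ℚ ℚ.≤ ιℕ k
  0≤ιℕ k = ℚ.nonNegative⁻¹ (ιℕ k) {{ ℚ.normalize-nonNeg k 1 }}

  halves-n : ∀ n → + n / 2 + + n / 2 ≡ ιℕ n
  halves-n n = ℚ.toℚᵘ-injective (begin
    toℚᵘ (+ n / 2 + + n / 2)              ≈⟨ ℚ.toℚᵘ-homo-+ (+ n / 2) (+ n / 2) ⟩
    toℚᵘ (+ n / 2) ℚᵘ.+ toℚᵘ (+ n / 2)    ≈⟨ ℚᵘ.+-cong (ℚ.toℚᵘ-fromℚᵘ (mkℚᵘ (+ n) 1)) (ℚ.toℚᵘ-fromℚᵘ (mkℚᵘ (+ n) 1)) ⟩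
    mkℚᵘ (+ n) 1 ℚᵘ.+ mkℚᵘ (+ n) 1        ≈⟨ *≡* (double (+ n)) ⟩
    mkℚᵘ (+ n) 0                          ≈⟨ toℚᵘ-ι (+ n) ⟨
    toℚᵘ (ιℕ n)                           ∎)
    where
    open import Relation.Binary.Reasoning.Setoid ℚᵘ.≃-setoid
    double : ∀ x → (x ℤ.* + 2 ℤ.+ x ℤ.* + 2) ℤ.* + 1 ≡ x ℤ.* + 4
    double = ℤ-Solver.solve-∀

  open +-*-Solver using (solve; _:=_; _:+_; _:*_; _:-_; :-_; con)

  infixr 6 _⊞_
  infixr 7 _⊠_

  _⊞_ : ∀ {x y} → 0ℚ ℚ.≤ x → 0ℚ ℚ.≤ y → 0ℚ ℚ.≤ x + y
  _⊞_ = ℚ.+-mono-≤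

  _⊠_ : ∀ {x y} → 0ℚ ℚ.≤ x → 0ℚ ℚ.≤ y → 0ℚ ℚ.≤ x * y
  _⊠_ {x} {y} 0≤x 0≤y = subst (ℚ._≤ x * y) (ℚ.*-zeroʳ x) (ℚ.*-monoˡ-≤-nonNeg x {{ℚ.nonNegative 0≤x}} 0≤y)

  difference : ∀ {x y} → x ℚ.≤ y → 0ℚ ℚ.≤ y - x
  difference {x} {y} x≤y = subst (ℚ._≤ y - x) (ℚ.+-inverseʳ x) (ℚ.+-monoˡ-≤ (- x) x≤y)

  pℚ : ℚ → ℚ → ℚ
  pℚ N q = (N - ιℕ 2 * q + ιℕ 1) * (N - ιℕ 2 * q + ιℕ 2) - q * (N - q)

  -- The data of one late enough term of the Cauchy sequence. The bound by A + 1 carries no error,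
  -- because the strict inequality r < A + 1 leaves a margin.
  record RationalRoot (n A : ℕ) (ε : ℚ) : Set where
    field
      root     : ℚ
      0≤root+ε : 0ℚ ℚ.≤ root + ε
      root≤n/2 : root ℚ.≤ + n / 2 + ε
      p≤ε      : pℚ (ιℕ n) root ℚ.≤ ε
      -ε≤p     : - ε ℚ.≤ pℚ (ιℕ n) root
      A≤root+ε : ιℕ A ℚ.≤ root + ε
      root≤1+A : root ℚ.≤ ιℕ (suc A)

  p≤∣p∣ : ∀ x → x ℚ.≤ ℚ.∣ x ∣
  p≤∣p∣ x with ℚ.≤-total 0ℚ x
  ... | inj₁ 0≤x = ℚ.≤-reflexive (sym (ℚ.0≤p⇒∣p∣≡p 0≤x))
  ... | inj₂ x≤0 = ℚ.≤-trans x≤0 (ℚ.0≤∣p∣ x)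

  approximate : ∀ {n A r} → IsRootIn[0,n/2] n r → IsFloor r A → ∀ {ε} → 0ℚ ℚ.< ε → RationalRoot n A ε
  approximate {n} {A} {r} isRoot isFloor {ε} 0<ε
    with IsRootIn[0,n/2].0≤r isRoot ε 0<ε | IsRootIn[0,n/2].r≤n/2 isRoot ε 0<ε | IsRootIn[0,n/2].pr≃0 isRoot ε 0<ε
       | IsFloor.A≤r isFloor ε 0<ε | IsFloor.r<1+A isFloor
  ... | N₁ , lower | N₂ , upper | N₃ , small | N₄ , floor≤ | γ , 0<γ , N₅ , <ceiling = record
    { root     = q
    ; 0≤root+ε = lower i (ℕ.m≤m+n N₁ _)
    ; root≤n/2 = upper i (ℕ.≤-trans (ℕ.m≤m+n N₂ _) (ℕ.m≤n+m _ N₁))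
    ; p≤ε      = subst (ℚ._≤ ε) minus-0 (ℚ.≤-trans (p≤∣p∣ _) ∣p∣≤ε)
    ; -ε≤p     = subst (- ε ℚ.≤_) (trans (neg-involutive _) minus-0) (ℚ.neg-antimono-≤ (ℚ.≤-trans (p≤∣p∣ _) (subst (ℚ._≤ ε) (sym (ℚ.∣-p∣≡∣p∣ _)) ∣p∣≤ε)))
    ; A≤root+ε = floor≤ i (ℕ.≤-trans (ℕ.m≤m+n N₄ _) (ℕ.≤-trans (ℕ.m≤n+m _ N₃) (ℕ.≤-trans (ℕ.m≤n+m _ N₂) (ℕ.m≤n+m _ N₁))))
    ; root≤1+A = ℚ.≤-trans
        (subst (ℚ._≤ q + γ) (ℚ.+-identityʳ q) (ℚ.+-monoʳ-≤ q (ℚ.<⇒≤ 0<γ)))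
        (<ceiling i (ℕ.≤-trans (ℕ.m≤n+m _ N₄) (ℕ.≤-trans (ℕ.m≤n+m _ N₃) (ℕ.≤-trans (ℕ.m≤n+m _ N₂) (ℕ.m≤n+m _ N₁)))))
    }
    where
    i : ℕ
    i = N₁ ℕ.+ (N₂ ℕ.+ (N₃ ℕ.+ (N₄ ℕ.+ N₅)))
    q : ℚ
    q = seq r i
    minus-0 : pℚ (ιℕ n) q - 0ℚ ≡ pℚ (ιℕ n) q
    minus-0 = ℚ.+-identityʳ (pℚ (ιℕ n) q)
    neg-involutive : ∀ x → - - x ≡ x
    neg-involutive = solve 1 (λ x → :- :- x := x) refl
    ∣p∣≤ε : ℚ.∣ pℚ (ιℕ n) q - 0ℚ ∣ ℚ.≤ ε
    ∣p∣≤ε = small i (ℕ.≤-trans (ℕ.m≤m+n N₃ _) (ℕ.≤-trans (ℕ.m≤n+m _ N₂) (ℕ.m≤n+m _ N₁)))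

  -- The constant is fitted to `p[floor]>-1`: one ε is the strict margin, one is the error of p n q,
  -- and the error of q against A is multiplied by D, which is at most 5n + 11.
  reciprocal : ∀ n → ∃[ ε ] 0ℚ ℚ.< ε Product.× ε * (ιℕ 5 * ιℕ n + ιℕ 13) ≡ 1ℚ
  reciprocal n = 1/ K , ℚ.positive⁻¹ (1/ K) , ℚ.*-inverseˡ K
    where
    K : ℚ
    K = ιℕ 5 * ιℕ n + ιℕ 13
    instance
      K-pos : ℚ.Positive K
      K-pos = ℚ.positive (ℚ.+-mono-≤-< (0≤ιℕ 5 ⊠ 0≤ιℕ n) (ℚ.positive⁻¹ (ιℕ 13)))
      K-nonZero : ℚ.NonZero K
      K-nonZero = ℚ.pos⇒nonZero K
      1/K-pos : ℚ.Positive (1/ K)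
      1/K-pos = ℚ.1/pos⇒pos K

  -- p n a = p n q + (q - a) D, where D is positive when a and q are at most n / 2.
  module _ (n : ℕ) where

    private
      N h : ℚ
      N = ιℕ n
      h = + n / 2

    D : ℚ → ℚ → ℚ
    D a q = ιℕ 5 * N + ιℕ 6 - ιℕ 5 * a - ιℕ 5 * q

    -- An integer above -1 is nonnegative. Since a may exceed q by ε, the product (q - a) D can be
    -- as low as - ε D, and the upper bound on D controls this loss.
    p[floor]>-1 : ∀ {A ε} → 0ℚ ℚ.< ε → ε * (ιℕ 5 * N + ιℕ 13) ≡ 1ℚ → RationalRoot n A ε → 0ℚ ℚ.< pℚ N (ιℕ A) + 1ℚ
    p[floor]>-1 {A} {ε} 0<ε εK≡1 approx = subst (0ℚ ℚ.<_) (sym split) (ℚ.+-mono-<-≤ 0<ε (p+ε ⊞ s ⊠ 0≤D ⊞ 0≤ε ⊠ 0≤E))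
      where
      open RationalRoot approx renaming (root to q)
      a : ℚ
      a = ιℕ A
      0≤ε : 0ℚ ℚ.≤ ε
      0≤ε = ℚ.<⇒≤ 0<ε
      s : 0ℚ ℚ.≤ q + ε - a
      s = difference A≤root+ε
      t : 0ℚ ℚ.≤ h + ε - q
      t = difference root≤n/2
      p+ε : 0ℚ ℚ.≤ pℚ N q + ε
      p+ε = subst (0ℚ ℚ.≤_) (solve 2 (λ x e → x :- (:- e) := x :+ e) refl (pℚ N q) ε) (difference -ε≤p)
      -- Dropping 5 n ε from ε (5n + 13) = 1 makes ε small independently of n.
      1-13ε : 0ℚ ℚ.≤ 1ℚ - ιℕ 13 * ε
      1-13ε = subst (0ℚ ℚ.≤_)
        (trans (solve 2 (λ e N → e :* (con (ιℕ 5) :* N) := e :* (con (ιℕ 5) :* N :+ con (ιℕ 13)) :- con (ιℕ 13) :* e) refl ε N)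
               (cong (_- ιℕ 13 * ε) εK≡1))
        (0≤ε ⊠ 0≤ιℕ 5 ⊠ 0≤ιℕ n)
      -- Replacing a and q by n / 2 costs 15 ε in total, which the constant 6 in D covers.
      0≤D : 0ℚ ℚ.≤ D a q
      0≤D = subst (0ℚ ℚ.≤_)
        (trans
          (solve 4 (λ q e a h →
            con (ιℕ 5) :* (q :+ e :- a) :+ (con (ιℕ 10) :* (h :+ e :- q)
              :+ (con (ιℕ 6) :* (con 1ℚ :- con (ιℕ 13) :* e) :+ con (ιℕ 63) :* e))
            := con (ιℕ 5) :* (h :+ h) :+ con (ιℕ 6) :- con (ιℕ 5) :* a :- con (ιℕ 5) :* q) refl q ε a h)
          (cong (λ N → ιℕ 5 * N + ιℕ 6 - ιℕ 5 * a - ιℕ 5 * q) (halves-n n)))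
        (0≤ιℕ 5 ⊠ s ⊞ 0≤ιℕ 10 ⊠ t ⊞ 0≤ιℕ 6 ⊠ 1-13ε ⊞ 0≤ιℕ 63 ⊠ 0≤ε)
      0≤E : 0ℚ ℚ.≤ ιℕ 5 * N + ιℕ 11 - D a q
      0≤E = subst (0ℚ ℚ.≤_)
        (solve 4 (λ q e a N →
            con (ιℕ 5) :* a :+ (con (ιℕ 5) :* (q :+ e) :+ con (ιℕ 5) :* ((con 1ℚ :- con (ιℕ 13) :* e) :+ con (ιℕ 12) :* e))
            := con (ιℕ 5) :* N :+ con (ιℕ 11) :- (con (ιℕ 5) :* N :+ con (ιℕ 6) :- con (ιℕ 5) :* a :- con (ιℕ 5) :* q))
          refl q ε a N)
        (0≤ιℕ 5 ⊠ 0≤ιℕ A ⊞ 0≤ιℕ 5 ⊠ 0≤root+ε ⊞ 0≤ιℕ 5 ⊠ (1-13ε ⊞ 0≤ιℕ 12 ⊠ 0≤ε))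
      split : pℚ N a + 1ℚ ≡ ε + ((pℚ N q + ε) + ((q + ε - a) * D a q + ε * (ιℕ 5 * N + ιℕ 11 - D a q)))
      split = trans (cong (_+_ (pℚ N a)) (sym εK≡1)) (solve 4 (λ q e a N →
        let D = con (ιℕ 5) :* N :+ con (ιℕ 6) :- con (ιℕ 5) :* a :- con (ιℕ 5) :* q
            P = λ z → (N :- con (ιℕ 2) :* z :+ con (ιℕ 1)) :* (N :- con (ιℕ 2) :* z :+ con (ιℕ 2)) :- z :* (N :- z)
        in P a :+ e :* (con (ιℕ 5) :* N :+ con (ιℕ 13))
           := e :+ ((P q :+ e) :+ ((q :+ e :- a) :* D :+ e :* (con (ιℕ 5) :* N :+ con (ιℕ 11) :- D))))
        refl q ε a N)

    -- As q ≤ A + 1 holds without error, (a - q) D is nonnegative and only the error of p n q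
    -- remains. So ε = ½ is small enough, independently of n.
    p[1+floor]<1 : ∀ {A} → ιℕ 2 * ιℕ (suc A) ℚ.≤ N → RationalRoot n A ½ → 0ℚ ℚ.< 1ℚ - pℚ N (ιℕ (suc A))
    p[1+floor]<1 {A} 2a≤N approx = subst (0ℚ ℚ.<_) (sym split)
      (ℚ.+-mono-<-≤ (ℚ.positive⁻¹ ½) (difference p≤ε ⊞ w ⊠ 0≤D))
      where
      open RationalRoot approx renaming (root to q)
      a : ℚ
      a = ιℕ (suc A)
      w : 0ℚ ℚ.≤ a - q
      w = difference root≤1+A
      0≤D : 0ℚ ℚ.≤ D a q
      0≤D = subst (0ℚ ℚ.≤_)
        (solve 3 (λ q a N →
          con (ιℕ 5) :* (a :- q) :+ (con (ιℕ 5) :* (N :- con (ιℕ 2) :* a) :+ con (ιℕ 6))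
          := con (ιℕ 5) :* N :+ con (ιℕ 6) :- con (ιℕ 5) :* a :- con (ιℕ 5) :* q) refl q a N)
        (0≤ιℕ 5 ⊠ w ⊞ 0≤ιℕ 5 ⊠ difference 2a≤N ⊞ 0≤ιℕ 6)
      split : 1ℚ - pℚ N a ≡ ½ + ((½ - pℚ N q) + (a - q) * D a q)
      split = solve 3 (λ q a N →
        let D = con (ιℕ 5) :* N :+ con (ιℕ 6) :- con (ιℕ 5) :* a :- con (ιℕ 5) :* q
            P = λ z → (N :- con (ιℕ 2) :* z :+ con (ιℕ 1)) :* (N :- con (ιℕ 2) :* z :+ con (ιℕ 2)) :- z :* (N :- z)
        in con 1ℚ :- P a := con ½ :+ ((con ½ :- P q) :+ (a :- q) :* D))
        refl q a N

    -- The passages from A to q and from q to n / 2 each cost 1/8, doubled to 1/2 in total.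
    -- Integrality then gives 2A ≤ n.
    2floor<n+1 : ∀ {A} → RationalRoot n A (+ 1 / 8) → ιℕ 2 * ιℕ A ℚ.< N + 1ℚ
    2floor<n+1 {A} approx = subst₂ ℚ._<_
        (ℚ.+-identityʳ (ιℕ 2 * a))
        (trans (solve 3 (λ q a h → con (ιℕ 2) :* a :+ (con ½ :+ (con (ιℕ 2) :* (q :+ con (+ 1 / 8) :- a) :+ con (ιℕ 2) :* (h :+ con (+ 1 / 8) :- q)))
          := h :+ h :+ con 1ℚ) refl q a h) (cong (_+ 1ℚ) (halves-n n)))
        (ℚ.+-monoʳ-< (ιℕ 2 * a) (ℚ.+-mono-<-≤ (ℚ.positive⁻¹ ½) (0≤ιℕ 2 ⊠ difference A≤root+ε ⊞ 0≤ιℕ 2 ⊠ difference root≤n/2)))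
      where
      open RationalRoot approx renaming (root to q)
      a : ℚ
      a = ιℕ A

  ιℕ-2a+b : ∀ a b {n} → 2 ℕ.* a ℕ.+ b ≡ n → ιℕ n ≡ ιℕ 2 * ιℕ a + ιℕ b
  ιℕ-2a+b a b 2a+b≡n = trans (cong ιℕ (sym 2a+b≡n)) (trans (ιℕ-+ (2 ℕ.* a) b) (cong (_+ ιℕ b) (ιℕ-* 2 a)))

  ιℕ-a[a+b] : ∀ a b → ιℕ (a ℕ.* (a ℕ.+ b)) ≡ ιℕ a * (ιℕ a + ιℕ b)
  ιℕ-a[a+b] a b = trans (ιℕ-* a (a ℕ.+ b)) (cong (ιℕ a *_) (ιℕ-+ a b))

  ιℕ-[2+b][1+b] : ∀ b → ιℕ ((2 ℕ.+ b) ℕ.* suc b) ≡ (ιℕ 2 + ιℕ b) * (ιℕ 1 + ιℕ b)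
  ιℕ-[2+b][1+b] b = trans (ιℕ-* (2 ℕ.+ b) (suc b)) (cong₂ _*_ (ιℕ-+ 2 b) (ιℕ-+ 1 b))

  module _ {n A r} (isRoot : IsRootIn[0,n/2] n r) (isFloor : IsFloor r A) where

    2A≤n : 2 ℕ.* A ℕ.≤ n
    2A≤n = ℕ.≤-pred (ιℕ-cancel-< (subst₂ ℚ._<_ (sym (ιℕ-* 2 A))
      (trans (ℚ.+-comm (ιℕ n) 1ℚ) (sym (ιℕ-+ 1 n)))
      (2floor<n+1 n {A} (approximate isRoot isFloor (ℚ.positive⁻¹ (+ 1 / 8))))))

    p[A]≥0 : ∀ {B} → 2 ℕ.* A ℕ.+ B ≡ n → A ℕ.* (A ℕ.+ B) ℕ.≤ (2 ℕ.+ B) ℕ.* suc B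
    p[A]≥0 {B} 2A+B≡n =
      let ε , 0<ε , εK≡1 = reciprocal n
      in ℕ.≤-pred (ιℕ-cancel-< (subst₂ ℚ._<_
        (ℚ.+-identityʳ (ιℕ (A ℕ.* (A ℕ.+ B))))
        (trans (pℚ-value {ιℕ n} {ιℕ A} {ιℕ B} (ιℕ-2a+b A B 2A+B≡n) (ιℕ-a[a+b] A B) (ιℕ-[2+b][1+b] B)) (sym (ιℕ-+ 1 ((2 ℕ.+ B) ℕ.* suc B))))
        (ℚ.+-monoʳ-< (ιℕ (A ℕ.* (A ℕ.+ B))) (p[floor]>-1 n {A} 0<ε εK≡1 (approximate isRoot isFloor 0<ε)))))
      where
      pℚ-value : ∀ {N a b y z} → N ≡ ιℕ 2 * a + b → y ≡ a * (a + b) → z ≡ (ιℕ 2 + b) * (ιℕ 1 + b) →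
                 y + (pℚ N a + 1ℚ) ≡ 1ℚ + z
      pℚ-value {a = a} {b} refl refl refl = solve 2 (λ a b →
        let N = con (ιℕ 2) :* a :+ b
        in a :* (a :+ b) :+ ((N :- con (ιℕ 2) :* a :+ con (ιℕ 1)) :* (N :- con (ιℕ 2) :* a :+ con (ιℕ 2)) :- a :* (N :- a) :+ con 1ℚ)
           := con 1ℚ :+ (con (ιℕ 2) :+ b) :* (con (ιℕ 1) :+ b)) refl a b

    p[1+A]≤0 : ∀ {B} → 2 ℕ.* A ℕ.+ (2 ℕ.+ B) ≡ n → (2 ℕ.+ B) ℕ.* suc B ℕ.≤ suc A ℕ.* suc (A ℕ.+ B)
    p[1+A]≤0 {B} 2A+2+B≡n = ℕ.≤-pred (ιℕ-cancel-< (subst₂ ℚ._<_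
        (ℚ.+-identityʳ (ιℕ ((2 ℕ.+ B) ℕ.* suc B)))
        (trans (pℚ-value {ιℕ n} {ιℕ (suc A)} {ιℕ B} n≡ (ιℕ-[2+b][1+b] B) (ιℕ-a[a+b] (suc A) B)) (sym (ιℕ-+ 1 (suc A ℕ.* suc (A ℕ.+ B)))))
        (ℚ.+-monoʳ-< (ιℕ ((2 ℕ.+ B) ℕ.* suc B)) (p[1+floor]<1 n {A} 2[1+A]≤n (approximate isRoot isFloor (ℚ.positive⁻¹ ½))))))
      where
      regroup : ∀ A B → 2 ℕ.* suc A ℕ.+ B ≡ 2 ℕ.* A ℕ.+ (2 ℕ.+ B)
      regroup = solve-∀
      n≡ : ιℕ n ≡ ιℕ 2 * ιℕ (suc A) + ιℕ B
      n≡ = ιℕ-2a+b (suc A) B (trans (regroup A B) 2A+2+B≡n)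
      2[1+A]≤n : ιℕ 2 * ιℕ (suc A) ℚ.≤ ιℕ n
      2[1+A]≤n = subst₂ ℚ._≤_ (ℚ.+-identityʳ (ιℕ 2 * ιℕ (suc A))) (sym n≡) (ℚ.+-monoʳ-≤ (ιℕ 2 * ιℕ (suc A)) (0≤ιℕ B))
      pℚ-value : ∀ {N a b y z} → N ≡ ιℕ 2 * a + b → y ≡ (ιℕ 2 + b) * (ιℕ 1 + b) → z ≡ a * (a + b) →
                 y + (1ℚ - pℚ N a) ≡ 1ℚ + z
      pℚ-value {a = a} {b} refl refl refl = solve 2 (λ a b →
        let N = con (ιℕ 2) :* a :+ b
        in (con (ιℕ 2) :+ b) :* (con (ιℕ 1) :+ b)
           :+ (con 1ℚ :- ((N :- con (ιℕ 2) :* a :+ con (ιℕ 1)) :* (N :- con (ιℕ 2) :* a :+ con (ιℕ 2)) :- a :* (N :- a)))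
           := con 1ℚ :+ a :* (a :+ b)) refl a b

open LucasNumbers
open RationalApproximation using (2A≤n; p[A]≥0; p[1+A]≤0)
open Product using (_×_)
open import Data.Rational.Base using (_/_)

-- Heights and the final formula

coeff-listed : ∀ {k} (P : Poly k) {α} → coeff P α ≢ ℤ.0ℤ → Any (λ (_ , β) → β ≡ α) P
coeff-listed []            ≢0 = contradiction refl ≢0
coeff-listed ((c , β) ∷ P) {α} ≢0 with Vec.≡-dec ℕ._≟_ β α
... | yes β≡α = here β≡α
... | no _    = there (coeff-listed P λ ≡0 → ≢0 (trans (ℤ.+-identityˡ _) ≡0))

-- `H` inspects only listed monomials. As M is positive, the coefficient at α is nonzero, so α is
-- listed and the maximum is reached there.
H-attained : ∀ {k M} (P : Poly k) α → (∀ β → ∣ coeff P β ∣ ≤ M) → ∣ coeff P α ∣ ≡ M → 1 ≤ M → H P ≡ M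
H-attained {M = M} P α bound attained 1≤M = ℕ.≤-antisym
  (max≤v⁺ ℕ.z≤n (All.map⁺ (All.universal (λ (_ , β) → bound β) P)))
  (v≤max⁺ 0 _ (inj₂ (Any.map⁺ (Any.map (λ { refl → ℕ.≤-reflexive (sym attained) }) (coeff-listed P ≢0)))))
  where
  open Data.List.Extrema ℕ.≤-totalOrder using (max≤v⁺; v≤max⁺)
  ≢0 : coeff P α ≢ ℤ.0ℤ
  ≢0 ≡0 = contradiction (subst (1 ≤_) (sym (trans (cong ∣_∣ (sym ≡0)) attained)) 1≤M) λ ()

/-exact : ∀ l {x} d .{{_ : ℕ.NonZero d}} → l ℕ.* d ≡ x → + l / 1 ≡ + x / d
/-exact l (suc d) refl = ℚ.fromℚᵘ-cong {mkℚᵘ (+ l) 0} {mkℚᵘ (+ (l ℕ.* suc d)) d} (*≡* (trans (sym (ℤ.pos-* l (suc d))) (sym (ℤ.*-identityʳ _))))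

heightFormula-lucas : ∀ n A → 1 ≤ n → 2 ℕ.* A ≤ n → + lucas A (n ∸ 2 ℕ.* A) / 1 ≡ heightFormula n A
heightFormula-lucas n A 1≤n 2A≤n = /-exact (lucas A B) (B ! ℕ.* A !) {{B ℕ.!* A !≢0}} (begin
  lucas A B ℕ.* (B ! ℕ.* A !)          ≡⟨ cong (lucas A B ℕ.*_) (ℕ.*-comm (B !) (A !)) ⟩
  lucas A B ℕ.* (A ! ℕ.* B !)          ≡⟨ lucas-! A B (sym (ℕ.suc-pred (A ℕ.+ B) {{ℕ.>-nonZero A+B>0}})) ⟩
  (2 ℕ.* A ℕ.+ B) ℕ.* ℕ.pred (A ℕ.+ B) !  ≡⟨ cong₂ (λ s t → s ℕ.* t !) 2A+B≡n (sym n∸A∸1≡) ⟩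
  n ℕ.* (n ∸ A ∸ 1) !                  ∎)
  where
  open ≡-Reasoning
  B : ℕ
  B = n ∸ 2 ℕ.* A
  2A+B≡n : 2 ℕ.* A ℕ.+ B ≡ n
  2A+B≡n = ℕ.m+[n∸m]≡n 2A≤n
  n≡ : n ≡ A ℕ.+ (A ℕ.+ B)
  n≡ = trans (sym 2A+B≡n) (trans (cong (λ z → A ℕ.+ z ℕ.+ B) (ℕ.+-identityʳ A)) (ℕ.+-assoc A A B))
  n∸A∸1≡ : n ∸ A ∸ 1 ≡ ℕ.pred (A ℕ.+ B)
  n∸A∸1≡ = cong (_∸ 1) (trans (cong (_∸ A) n≡) (ℕ.m+n∸m≡n A (A ℕ.+ B)))
  A+B>0 : 1 ≤ A ℕ.+ B
  A+B>0 with A ℕ.+ B in eq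
  ... | suc _ = ℕ.s≤s ℕ.z≤n
  ... | zero  = contradiction (subst (1 ≤_) (trans n≡ (trans (cong (A ℕ.+_) eq) (cong (ℕ._+ 0) (ℕ.m+n≡0⇒m≡0 A eq)))) 1≤n) λ ()

-- The test inside `endsOnly`, so that `partialRes n (isEnd n)` unfolds to `resFEnds n`, just as
-- `const true` gives `resFG n`.
isEnd : ∀ n → Fin (suc n) → Bool
isEnd n i = does (i Fin.≟ zero) ∨ does (i Fin.≟ fromℕ n)

isEnd-last : ∀ n → isEnd n (fromℕ n) ≡ true
isEnd-last n with fromℕ n Fin.≟ fromℕ n
... | yes _ = Bool.∨-zeroʳ _
... | no ≢  = contradiction refl ≢

theorem1p1 : ∀ (n : ℕ) → 3 ≤ n →
    ∀ (rₙ : ℝ) → IsRootIn[0,n/2] n rₙ →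
    ∀ (Aₙ : ℕ) → IsFloor rₙ Aₙ →
    (∀ (α : Monomial (numVars n)) → ∣ coeff (resFG n) α ∣ ≤ ∣ coeff (resFG n) (topMonomial n Aₙ) ∣)
    × H (resFG n) ≡ H (resFEnds n)
    × (+ H (resFEnds n) / 1) ≡ heightFormula n Aₙ
theorem1p1 n 3≤n rₙ isRoot Aₙ isFloor =
  (λ α → subst (∣ coeff (resFG n) α ∣ ≤_) (sym FG-top) (coeff-bound n (const true) maximal α))
  , trans HFG (sym HEnds)
  , trans (cong (λ l → + l / 1) HEnds) (heightFormula-lucas n Aₙ (ℕ.≤-trans (ℕ.s≤s ℕ.z≤n) 3≤n) 2A≤n′)
  where
  B : ℕ
  B = n ∸ 2 ℕ.* Aₙ
  2A≤n′ : 2 ℕ.* Aₙ ≤ n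
  2A≤n′ = 2A≤n isRoot isFloor
  2A+B≡n : 2 ℕ.* Aₙ ℕ.+ B ≡ n
  2A+B≡n = ℕ.m+[n∸m]≡n 2A≤n′
  maximal : ∀ a b → 2 ℕ.* a ℕ.+ b ≤ n → lucas a b ≤ lucas Aₙ B
  maximal = lucas-maximal {A = Aₙ} {B} 2A+B≡n (p[A]≥0 isRoot isFloor 2A+B≡n)
    (λ {B′} B≡2+B′ → p[1+A]≤0 isRoot isFloor (trans (cong (2 ℕ.* Aₙ ℕ.+_) (sym B≡2+B′)) 2A+B≡n))
  FG-top : ∣ coeff (resFG n) (topMonomial n Aₙ) ∣ ≡ lucas Aₙ B
  FG-top = coeff-top n (const true) refl refl {Aₙ} 2A≤n′
  Ends-top : ∣ coeff (resFEnds n) (topMonomial n Aₙ) ∣ ≡ lucas Aₙ B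
  Ends-top = coeff-top n (isEnd n) refl (isEnd-last n) {Aₙ} 2A≤n′
  HFG : H (resFG n) ≡ lucas Aₙ B
  HFG = H-attained (resFG n) (topMonomial n Aₙ) (coeff-bound n (const true) maximal) FG-top (lucas-positive Aₙ B)
  HEnds : H (resFEnds n) ≡ lucas Aₙ B
  HEnds = H-attained (resFEnds n) (topMonomial n Aₙ) (coeff-bound n (isEnd n) maximal) Ends-top (lucas-positive Aₙ B)
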